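{- Let $p$ be a prime with $p\equiv5$ or $7\pmod 8$. Then $S_{\frac{p^2-1}{2}}\equiv0\pmod{p^2}$ and $f_{\frac{p^2-1}{2}}\equiv0\pmod{p^2}$.
   Context: $(S_n)_{n\ge0}$ is the integer sequence defined by $S_0=1$, $S_1=4$ and $(n+1)^2S_{n+1}=4(3n^2+3n+1)S_n-32n^2S_{n-1}$ for $n\ge1$; equivalently $S_n=\sum_{k=0}^n\binom nk\binom{2k}k\binom{2n-2k}{n-k}$. The Franel numbers are $f_n=\sum_{k=0}^n\binom nk^3$. -}

module Defs where

open import Data.Nat.Base using (ℕ; suc; _+_; _*_; _∸_; _^_; _≥_)
open import Data.Nat.Combinatorics using (_C_)
open import Data.Nat.ListAction using (sum)
open import Data.Integer.Base as ℤ using (ℤ; +_)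
open import Data.List.Base using (map; upTo)
open import Relation.Binary.PropositionalEquality.Core using (_≡_)

-- (Sₙ) is given by its initial values and recurrence.  The leading
-- coefficient (n + 1)² is nonzero, so at most one integer sequence satisfies
-- these equations; it is Sₙ = Σ_{k=0}^n C(n,k) C(2k,k) C(2n-2k,n-k).
record IsSSequence (S : ℕ → ℤ) : Set where
  field
    S₀         : S 0 ≡ + 1
    S₁         : S 1 ≡ + 4
    recurrence : ∀ n → n ≥ 1 →
      + ((n + 1) ^ 2) ℤ.* S (n + 1)
        ≡ + (4 * (3 * n ^ 2 + 3 * n + 1)) ℤ.* S n
          ℤ.- + (32 * n ^ 2) ℤ.* S (n ∸ 1)

franel : ℕ → ℕ
franel n = sum (map (λ k → (n C k) ^ 3) (upTo (suc n)))

{-# OPTIONS --safe #-}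

-- Write p = 2m + 1, so that (p² − 1)/2 = m + m p.  Let F(k, l) be either
-- C(k+l, k) C(2k, k) C(2l, l) or C(k+l, k)³, so that both sequences are
-- antidiagonal sums of F.
--
-- Modulo p², the summands of index m + m p for which the last base-p digits of
-- k and l exceed m vanish because each of them contains two factors with a
-- carry.  For the others, with k = b + a p and l = b′ + a′ p,
-- F(k, l) ≡ F(a p, a′ p) (u + p (a v + a′ v′)) with u, v, v′ depending only on
-- b and b′.  By the symmetry of F the sum of a F(a p, a′ p) over a + a′ = m is
-- m/2 times the sum of F(a p, a′ p), so everything vanishes modulo p² as soon
-- as the m-th term of the sequence vanishes modulo p.
--
-- Modulo p, the recurrence of S is symmetric under n ↦ p − 1 − n, which gives
-- 32ⁿ S_{p−1−n} ≡ S_{p−1} Sₙ.  At n = m this reads 32ᵐ S_m ≡ S_{p−1} S_m, where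
-- 32ᵐ ≡ (2/p) and S_{p−1} ≡ (−1)ᵐ; these differ for p ≡ 5, 7 (mod 8), hence
-- S_m ≡ 0.  Finally C(2k, k) ≡ (−4)ᵏ C(m, k) yields S_m ≡ (−4)ᵐ f_m.
module Submission where

open import Defs
open import Data.Integer.Base as ℤ using (ℤ; +_; _+_; _*_; _-_; -_; 0ℤ; 1ℤ; -1ℤ)
open import Data.Integer.Divisibility using () renaming (_∣_ to _∣ℤ_)
open import Data.Integer.Divisibility.Signed
  using (divides; ∣m∣n⇒∣m+n; ∣n⇒∣m*n; 0∣⇒≡0; ∣ᵤ⇒∣; ∣⇒∣ᵤ) renaming (_∣_ to _∣ₛ_; ∣-trans to ∣ₛ-trans)
import Data.Integer.Properties as ℤ
open import Data.Integer.Tactic.RingSolver using (solve-∀)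
open import Data.List.Base using (applyUpTo)
open import Data.List.Properties using (map-upTo)
open import Data.Nat.Base as ℕ
  using (ℕ; zero; suc; _∸_; _^_; _!; _<_; _≤_; z≤n; s≤s; NonZero)
open import Data.Nat.Combinatorics using (_C_; nCk≡nC[n∸k]; k![n∸k]!∣n!)
open import Data.Nat.Combinatorics.Specification using (nCk≡n!/k![n-k]!)
open import Data.Nat.Coprimality using (prime⇒coprime; coprime-Bézout)
open import Data.Nat.DivMod using (_/_; _%_; m≡m%n+[m/n]*n; m*n/n≡m; m/n*n≡m)
open import Data.Nat.Divisibility using (_∣_; ∣-trans; m∣m*n; m≤n⇒m!∣n!)
open import Data.Nat.GCD using (module Bézout)
open import Data.Nat.ListAction using (sum)
open import Data.Nat.Primality using (Prime)
import Data.Nat.Properties as ℕ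
import Data.Nat.Tactic.RingSolver as ℕ
open import Data.Product.Base using (_×_; _,_; ∃; proj₁; proj₂)
open import Data.Sum.Base using (_⊎_; inj₁; inj₂)
open import Function.Base using (flip; _∘_; _$_)
open import Relation.Binary.Bundles using (Setoid)
open import Relation.Binary.PropositionalEquality
import Relation.Binary.Reasoning.Setoid as SetoidReasoning

-- Congruences

infix 4 _≡_[mod_]

-- A record rather than a synonym for `N ∣ₛ x - y`: the endpoints `x` and `y` can then be inferred,
-- which unification cannot do from a difference.
record _≡_[mod_] (x y N : ℤ) : Set where
  constructor congruent
  field divides-difference : N ∣ₛ x - y

open _≡_[mod_]

infixl 6 _⊕_
infix  7 _⊙_

-- Notation for elimination: a congruence is proved by writing its difference as an explicit
-- combination of differences already known to be divisible by `N`; the ring solver checks the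
-- identity.
_⊙_ : ∀ {N a b} c → a ≡ b [mod N ] → N ∣ₛ c * (a - b)
c ⊙ a≡b = ∣n⇒∣m*n c (divides-difference a≡b)

_⊕_ : ∀ {N u v} → N ∣ₛ u → N ∣ₛ v → N ∣ₛ u + v
_⊕_ = ∣m∣n⇒∣m+n

mod-linear : ∀ {N x y u} → N ∣ₛ u → x - y ≡ u → x ≡ y [mod N ]
mod-linear N∣u eq = congruent (subst (_∣ₛ_ _) (sym eq) N∣u)

-- Modulus 0 turns congruence into equality, so the same combinations also prove identities between
-- integers.
linear : ∀ {x y u} → 0ℤ ∣ₛ u → x - y ≡ u → x ≡ y
linear 0∣u eq = ℤ.i-j≡0⇒i≡j _ _ (trans eq (0∣⇒≡0 0∣u))

exact : ∀ {N x y} → x ≡ y → x ≡ y [mod N ]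
exact {N} {x} refl = congruent (divides 0ℤ (ℤ.+-inverseʳ x))

mod-refl : ∀ {N x} → x ≡ x [mod N ]
mod-refl = exact refl

mod-sym : ∀ {N x y} → x ≡ y [mod N ] → y ≡ x [mod N ]
mod-sym {x = x} {y} x≡y = mod-linear (-1ℤ ⊙ x≡y) (negate x y)
  where
  negate : ∀ x y → y - x ≡ -1ℤ * (x - y)
  negate = solve-∀

mod-trans : ∀ {N x y z} → x ≡ y [mod N ] → y ≡ z [mod N ] → x ≡ z [mod N ]
mod-trans {x = x} {y} {z} x≡y y≡z = mod-linear (1ℤ ⊙ x≡y ⊕ 1ℤ ⊙ y≡z) (telescope x y z)
  where
  telescope : ∀ x y z → x - z ≡ 1ℤ * (x - y) + 1ℤ * (y - z)
  telescope = solve-∀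

mod-+ : ∀ {N a b c d} → a ≡ b [mod N ] → c ≡ d [mod N ] → a + c ≡ b + d [mod N ]
mod-+ {a = a} {b} {c} {d} a≡b c≡d = mod-linear (1ℤ ⊙ a≡b ⊕ 1ℤ ⊙ c≡d) (rearrange a b c d)
  where
  rearrange : ∀ a b c d → (a + c) - (b + d) ≡ 1ℤ * (a - b) + 1ℤ * (c - d)
  rearrange = solve-∀

mod-* : ∀ {N a b c d} → a ≡ b [mod N ] → c ≡ d [mod N ] → a * c ≡ b * d [mod N ]
mod-* {a = a} {b} {c} {d} a≡b c≡d = mod-linear (c ⊙ a≡b ⊕ b ⊙ c≡d) (rearrange a b c d)
  where
  rearrange : ∀ a b c d → a * c - b * d ≡ c * (a - b) + b * (c - d)
  rearrange = solve-∀

mod-*ˡ : ∀ {N x y} c → x ≡ y [mod N ] → c * x ≡ c * y [mod N ]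
mod-*ˡ c = mod-* (mod-refl {x = c})

mod-product : ∀ {N x y} → x ≡ 0ℤ [mod N ] → y ≡ 0ℤ [mod N ] → x * y ≡ 0ℤ [mod N * N ]
mod-product {N} {x} {y} (congruent (divides c eq)) (congruent (divides d eq′)) =
  congruent (divides (c * d) (begin
    x * y - 0ℤ               ≡⟨ shift x y ⟩
    (x - 0ℤ) * (y - 0ℤ)      ≡⟨ cong₂ _*_ eq eq′ ⟩
    (c * N) * (d * N)        ≡⟨ rearrange c d N ⟩
    c * d * (N * N)          ∎))
  where
  open ≡-Reasoning
  shift : ∀ x y → x * y - 0ℤ ≡ (x - 0ℤ) * (y - 0ℤ)
  shift = solve-∀
  rearrange : ∀ c d n → (c * n) * (d * n) ≡ c * d * (n * n)
  rearrange = solve-∀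

mod-absorbˡ : ∀ {N x} y → x ≡ 0ℤ [mod N ] → x * y ≡ 0ℤ [mod N ]
mod-absorbˡ {x = x} y x≡0 = mod-linear (y ⊙ x≡0) (rearrange x y)
  where
  rearrange : ∀ x y → x * y - 0ℤ ≡ y * (x - 0ℤ)
  rearrange = solve-∀

mod-absorbʳ : ∀ {N y} x → y ≡ 0ℤ [mod N ] → x * y ≡ 0ℤ [mod N ]
mod-absorbʳ {y = y} x y≡0 = mod-linear (x ⊙ y≡0) (rearrange x y)
  where
  rearrange : ∀ x y → x * y - 0ℤ ≡ x * (y - 0ℤ)
  rearrange = solve-∀

mod-self : ∀ {N} → N ≡ 0ℤ [mod N ]
mod-self {N} = congruent (divides 1ℤ (trans (ℤ.+-identityʳ N) (sym (ℤ.*-identityˡ N))))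

mod-weaken : ∀ {N K x y} → K ∣ₛ N → x ≡ y [mod N ] → x ≡ y [mod K ]
mod-weaken K∣N (congruent N∣x-y) = congruent (∣ₛ-trans K∣N N∣x-y)

mod-setoid : ℤ → Setoid _ _
mod-setoid N = record
  { Carrier       = ℤ
  ; _≈_           = λ x y → x ≡ y [mod N ]
  ; isEquivalence = record { refl = mod-refl ; sym = mod-sym ; trans = mod-trans }
  }

module mod-Reasoning (N : ℤ) = SetoidReasoning (mod-setoid N)

record Invertible (N u : ℤ) : Set where
  constructor has-inverse
  field
    inverse   : ℤ
    *-inverse : u * inverse ≡ 1ℤ [mod N ]

mod-cancel : ∀ {N u x y} → Invertible N u → u * x ≡ u * y [mod N ] → x ≡ y [mod N ]
mod-cancel {u = u} {x} {y} (has-inverse e ue≡1) ux≡uy =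
  mod-linear (e ⊙ ux≡uy ⊕ (y - x) ⊙ ue≡1) (rearrange u e x y)
  where
  rearrange : ∀ u e x y → x - y ≡ e * (u * x - u * y) + (y - x) * (u * e - 1ℤ)
  rearrange = solve-∀

invertible-* : ∀ {N u v} → Invertible N u → Invertible N v → Invertible N (u * v)
invertible-* {u = u} {v} (has-inverse d ud≡1) (has-inverse e ve≡1) =
  has-inverse (d * e) (mod-linear ((v * e) ⊙ ud≡1 ⊕ 1ℤ ⊙ ve≡1) (rearrange u v d e))
  where
  rearrange : ∀ u v d e → u * v * (d * e) - 1ℤ ≡ v * e * (u * d - 1ℤ) + 1ℤ * (v * e - 1ℤ)
  rearrange = solve-∀

-- One Newton step: replacing e by e (2 - u e) turns the error u e - 1 into -(u e - 1)².
invertible-square : ∀ {N u} → Invertible N u → Invertible (N * N) u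
invertible-square {N} {u} (has-inverse e (congruent (divides q ue-1≡qN))) =
  has-inverse (e * (+ 2 - u * e)) (congruent (divides (- (q * q)) (begin
    u * (e * (+ 2 - u * e)) - 1ℤ       ≡⟨ complete u e ⟩
    - ((u * e - 1ℤ) * (u * e - 1ℤ))    ≡⟨ cong (λ x → - (x * x)) ue-1≡qN ⟩
    - (q * N * (q * N))                ≡⟨ rearrange q N ⟩
    - (q * q) * (N * N)                ∎)))
  where
  open ≡-Reasoning
  complete : ∀ u e → u * (e * (+ 2 - u * e)) - 1ℤ ≡ - ((u * e - 1ℤ) * (u * e - 1ℤ))
  complete = solve-∀
  rearrange : ∀ q n → - (q * n * (q * n)) ≡ - (q * q) * (n * n)
  rearrange = solve-∀

prime⇒invertible : ∀ {p} → Prime p → ∀ u → suc u < p → Invertible (+ p) (+ suc u)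
prime⇒invertible {p} p-prime u u<p with coprime-Bézout (prime⇒coprime p-prime u<p)
... | Bézout.+- x y eq = has-inverse (- + y) (congruent (divides (- + x) (begin
  + suc u * - + y - 1ℤ      ≡⟨ rearrange (+ suc u) (+ y) ⟩
  - (1ℤ + + y * + suc u)    ≡⟨ cong (λ z → - (1ℤ + z)) (ℤ.pos-* y (suc u)) ⟨
  - + (1 ℕ.+ y ℕ.* suc u)   ≡⟨ cong (λ z → - + z) eq ⟩
  - + (x ℕ.* p)             ≡⟨ cong -_ (ℤ.pos-* x p) ⟩
  - (+ x * + p)             ≡⟨ ℤ.neg-distribˡ-* (+ x) (+ p) ⟩
  - + x * + p               ∎)))
  where
  open ≡-Reasoning
  rearrange : ∀ u y → u * - y - 1ℤ ≡ - (1ℤ + y * u)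
  rearrange = solve-∀
... | Bézout.-+ x y eq = has-inverse (+ y) (congruent (divides (+ x) (begin
  + suc u * + y - 1ℤ           ≡⟨ cong (_- 1ℤ) (ℤ.*-comm (+ suc u) (+ y)) ⟩
  + y * + suc u - 1ℤ           ≡⟨ cong (_- 1ℤ) (ℤ.pos-* y (suc u)) ⟨
  + (y ℕ.* suc u) - 1ℤ         ≡⟨ cong (λ z → + z - 1ℤ) eq ⟨
  + (1 ℕ.+ x ℕ.* p) - 1ℤ       ≡⟨ cong (λ z → 1ℤ + z - 1ℤ) (ℤ.pos-* x p) ⟩
  1ℤ + + x * + p - 1ℤ          ≡⟨ rearrange (+ x * + p) ⟩
  + x * + p                    ∎)))
  where
  open ≡-Reasoning
  rearrange : ∀ z → 1ℤ + z - 1ℤ ≡ z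
  rearrange = solve-∀

-- Sums over antidiagonals and binomial coefficients

-- Passing both `k` and `l` with `k + l = n` avoids truncated subtraction and makes the symmetry of
-- the summands an instance of `flip`.
anti : ℕ → (ℕ → ℕ → ℤ) → ℤ
anti zero    f = f 0 0
anti (suc n) f = f 0 (suc n) + anti n (f ∘ suc)

-- The relation is left general so that equality and congruence modulo `N` share one proof.
anti-rel : ∀ (_~_ : ℤ → ℤ → Set) →
           (∀ {u v x y} → u ~ v → x ~ y → (u + x) ~ (v + y)) →
           ∀ n {f g} → (∀ k l → k ℕ.+ l ≡ n → f k l ~ g k l) → anti n f ~ anti n g
anti-rel _~_ +-pres zero    f~g = f~g 0 0 refl
anti-rel _~_ +-pres (suc n) f~g =
  +-pres (f~g 0 (suc n) refl) (anti-rel _~_ +-pres n (λ k l eq → f~g (suc k) l (cong suc eq)))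

anti-cong : ∀ n {f g} → (∀ k l → k ℕ.+ l ≡ n → f k l ≡ g k l) → anti n f ≡ anti n g
anti-cong = anti-rel _≡_ (cong₂ _+_)

anti-+ : ∀ n f g → anti n (λ k l → f k l + g k l) ≡ anti n f + anti n g
anti-+ zero    f g = refl
anti-+ (suc n) f g =
  trans (cong (_+_ ((f 0 (suc n) + g 0 (suc n)))) (anti-+ n (f ∘ suc) (g ∘ suc)))
        (interchange (f 0 (suc n)) (g 0 (suc n)) (anti n (f ∘ suc)) (anti n (g ∘ suc)))
  where
  interchange : ∀ a b c d → (a + b) + (c + d) ≡ (a + c) + (b + d)
  interchange = solve-∀

anti-*ˡ : ∀ n c f → anti n (λ k l → c * f k l) ≡ c * anti n f
anti-*ˡ zero    c f = refl
anti-*ˡ (suc n) c f =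
  trans (cong (_+_ (c * f 0 (suc n))) (anti-*ˡ n c (f ∘ suc))) (sym (ℤ.*-distribˡ-+ c (f 0 (suc n)) _))

anti-last : ∀ n f → anti (suc n) f ≡ anti n (λ k l → f k (suc l)) + f (suc n) 0
anti-last zero    f = refl
anti-last (suc n) f =
  trans (cong (_+_ (f 0 (suc (suc n)))) (anti-last n (f ∘ suc)))
        (sym (ℤ.+-assoc (f 0 (suc (suc n))) (anti n (λ k l → f (suc k) (suc l))) _))

anti-flip : ∀ n f → anti n (flip f) ≡ anti n f
anti-flip zero    f = refl
anti-flip (suc n) f = begin
  f (suc n) 0 + anti n (λ k l → f l (suc k)) ≡⟨ cong (_+_ (f (suc n) 0)) (anti-flip n (λ k l → f k (suc l))) ⟩
  f (suc n) 0 + anti n (λ k l → f k (suc l)) ≡⟨ ℤ.+-comm (f (suc n) 0) _ ⟩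
  anti n (λ k l → f k (suc l)) + f (suc n) 0 ≡⟨ anti-last n f ⟨
  anti (suc n) f                               ∎
  where open ≡-Reasoning

-- The antidiagonal is cut between first index `x` and `suc x`; beyond the cut the first index is at
-- least `suc x`, before it the second is at least `suc y`.
anti-split : ∀ x y f →
  anti (x ℕ.+ suc y) f ≡ anti x (λ k l → f k (l ℕ.+ suc y)) + anti y (λ k l → f (k ℕ.+ suc x) l)
anti-split zero    y f = cong (_+_ (f 0 (suc y))) (anti-cong y λ k l _ → cong (λ i → f i l) (ℕ.+-comm 1 k))
anti-split (suc x) y f = begin
  f 0 (suc x ℕ.+ suc y) + anti (x ℕ.+ suc y) (f ∘ suc)
    ≡⟨ cong (_+_ (f 0 (suc x ℕ.+ suc y))) (anti-split x y (f ∘ suc)) ⟩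
  f 0 (suc x ℕ.+ suc y) ℤ.+
    (anti x (λ k l → f (suc k) (l ℕ.+ suc y)) + anti y (λ k l → f (suc (k ℕ.+ suc x)) l))
    ≡⟨ ℤ.+-assoc (f 0 (suc x ℕ.+ suc y)) (anti x (λ k l → f (suc k) (l ℕ.+ suc y))) _ ⟨
  anti (suc x) (λ k l → f k (l ℕ.+ suc y)) + anti y (λ k l → f (suc (k ℕ.+ suc x)) l)
    ≡⟨ cong (_+_ (anti (suc x) (λ k l → f k (l ℕ.+ suc y))))
         (anti-cong y λ k l _ → cong (λ i → f i l) (sym (ℕ.+-suc k (suc x)))) ⟩
  anti (suc x) (λ k l → f k (l ℕ.+ suc y)) + anti y (λ k l → f (k ℕ.+ suc (suc x)) l)
    ∎
  where open ≡-Reasoning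

anti-mod : ∀ {N} n {f g} → (∀ k l → k ℕ.+ l ≡ n → f k l ≡ g k l [mod N ]) →
           anti n f ≡ anti n g [mod N ]
anti-mod {N} = anti-rel (_≡_[mod N ]) mod-+

anti-zero : ∀ n → anti n (λ _ _ → 0ℤ) ≡ 0ℤ
anti-zero zero    = refl
anti-zero (suc n) = trans (ℤ.+-identityˡ _) (anti-zero n)

anti-vanish : ∀ {N} n {f} → (∀ k l → k ℕ.+ l ≡ n → f k l ≡ 0ℤ [mod N ]) → anti n f ≡ 0ℤ [mod N ]
anti-vanish n f≡0 = mod-trans (anti-mod n f≡0) (exact (anti-zero n))

anti-linear : ∀ n (w : ℕ → ℕ → ℤ) u p v v′ →
  anti n (λ k l → w k l * (u + p * (+ k * v + + l * v′))) ≡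
  u * anti n w + p * (v * anti n (λ k l → + k * w k l) + v′ * anti n (λ k l → + l * w k l))
anti-linear n w u p v v′ = begin
  anti n (λ k l → w k l * (u + p * (+ k * v + + l * v′)))
    ≡⟨ anti-cong n (λ k l _ → distribute (w k l) u p (+ k) (+ l) v v′) ⟩
  anti n (λ k l → u * w k l + p * (v * (+ k * w k l) + v′ * (+ l * w k l)))
    ≡⟨ anti-+ n (λ k l → u * w k l) (λ k l → p * (v * (+ k * w k l) + v′ * (+ l * w k l))) ⟩
  anti n (λ k l → u * w k l) + anti n (λ k l → p * (v * (+ k * w k l) + v′ * (+ l * w k l)))
    ≡⟨ cong₂ _+_ (anti-*ˡ n u w) (anti-*ˡ n p (λ k l → v * (+ k * w k l) + v′ * (+ l * w k l))) ⟩
  u * anti n w + p * anti n (λ k l → v * (+ k * w k l) + v′ * (+ l * w k l))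
    ≡⟨ cong (λ x → u * anti n w + p * x) (trans
         (anti-+ n (λ k l → v * (+ k * w k l)) (λ k l → v′ * (+ l * w k l)))
         (cong₂ _+_ (anti-*ˡ n v (λ k l → + k * w k l)) (anti-*ˡ n v′ (λ k l → + l * w k l)))) ⟩
  u * anti n w + p * (v * anti n (λ k l → + k * w k l) + v′ * anti n (λ k l → + l * w k l))
    ∎
  where
  open ≡-Reasoning
  distribute : ∀ w u p k l v v′ → w * (u + p * (k * v + l * v′)) ≡
               u * w + p * (v * (k * w) + v′ * (l * w))
  distribute = solve-∀

module _ (n : ℕ) (w : ℕ → ℕ → ℤ) (w-comm : ∀ k l → w k l ≡ w l k) where

  anti-first-moment-flip : anti n (λ k l → + l * w k l) ≡ anti n (λ k l → + k * w k l)
  anti-first-moment-flip = trans (anti-cong n λ k l _ → cong (_*_ (+ l)) (w-comm k l))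
                                 (anti-flip n (λ k l → + k * w k l))

  -- By symmetry the moments in `k` and in `l` agree, and their sum has the constant weight
  -- `k + l = n`.
  anti-first-moment : + 2 * anti n (λ k l → + k * w k l) ≡ + n * anti n w
  anti-first-moment = begin
    + 2 * anti n (λ k l → + k * w k l)
      ≡⟨ double (anti n (λ k l → + k * w k l)) ⟩
    anti n (λ k l → + k * w k l) + anti n (λ k l → + k * w k l)
      ≡⟨ cong (_+_ (anti n (λ k l → + k * w k l))) anti-first-moment-flip ⟨
    anti n (λ k l → + k * w k l) + anti n (λ k l → + l * w k l)
      ≡⟨ anti-+ n (λ k l → + k * w k l) (λ k l → + l * w k l) ⟨
    anti n (λ k l → + k * w k l + + l * w k l)
      ≡⟨ anti-cong n (λ k l eq → trans (sym (ℤ.*-distribʳ-+ (w k l) (+ k) (+ l)))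
                                       (cong (λ i → + i * w k l) eq)) ⟩
    anti n (λ k l → + n * w k l)
      ≡⟨ anti-*ˡ n (+ n) w ⟩
    + n * anti n w
      ∎
    where
    open ≡-Reasoning
    double : ∀ x → + 2 * x ≡ x + x
    double = solve-∀

-- Indexed by the two lower parts, the binomial coefficient is symmetric and needs no side condition
-- `k ≤ n`.
bin : ℕ → ℕ → ℤ
bin k l = + ((k ℕ.+ l) C k)

bin-! : ∀ k l → bin k l * + (k ! ℕ.* l !) ≡ + ((k ℕ.+ l) !)
bin-! k l = trans (sym (ℤ.pos-* ((k ℕ.+ l) C k) (k ! ℕ.* l !))) (cong (λ i → + i) eq)
  where
  k≤k+l = ℕ.m≤m+n k l
  instance
    k!l!≢0 : NonZero (k ! ℕ.* l !)
    k!l!≢0 = ℕ._!*_!≢0 k l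
    k![k+l∸k]!≢0 : NonZero (k ! ℕ.* (k ℕ.+ l ∸ k) !)
    k![k+l∸k]!≢0 = ℕ._!*_!≢0 k (k ℕ.+ l ∸ k)
  eq : ((k ℕ.+ l) C k) ℕ.* (k ! ℕ.* l !) ≡ (k ℕ.+ l) !
  eq = begin
    ((k ℕ.+ l) C k) ℕ.* (k ! ℕ.* l !)
      ≡⟨ cong (λ i → ((k ℕ.+ l) C k) ℕ.* (k ! ℕ.* i !)) (ℕ.m+n∸m≡n k l) ⟨
    ((k ℕ.+ l) C k) ℕ.* (k ! ℕ.* (k ℕ.+ l ∸ k) !)
      ≡⟨ cong (ℕ._* (k ! ℕ.* (k ℕ.+ l ∸ k) !)) (nCk≡n!/k![n-k]! k≤k+l) ⟩
    ((k ℕ.+ l) ! / (k ! ℕ.* (k ℕ.+ l ∸ k) !)) ℕ.* (k ! ℕ.* (k ℕ.+ l ∸ k) !)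
      ≡⟨ m/n*n≡m (k![n∸k]!∣n! k≤k+l) ⟩
    (k ℕ.+ l) ! ∎
    where open ≡-Reasoning

bin-comm : ∀ k l → bin k l ≡ bin l k
bin-comm k l = cong (λ i → + i) $ begin
  (k ℕ.+ l) C k           ≡⟨ nCk≡nC[n∸k] (ℕ.m≤m+n k l) ⟩
  (k ℕ.+ l) C (k ℕ.+ l ∸ k) ≡⟨ cong₂ _C_ (ℕ.+-comm k l) (ℕ.m+n∸m≡n k l) ⟩
  (l ℕ.+ k) C l           ∎
  where open ≡-Reasoning

-- After multiplication by k! l! both sides are (k + l + 1)!.
bin-sucˡ : ∀ k l → bin (suc k) l * + suc k ≡ bin k l * + suc (k ℕ.+ l)
bin-sucˡ k l = ℤ.*-cancelʳ-≡ _ _ (+ (k ! ℕ.* l !)) {{ℕ._!*_!≢0 k l}} $ begin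
  bin (suc k) l * + suc k * + (k ! ℕ.* l !)
    ≡⟨ ℤ.*-assoc (bin (suc k) l) (+ suc k) (+ (k ! ℕ.* l !)) ⟩
  bin (suc k) l * (+ suc k * + (k ! ℕ.* l !))
    ≡⟨ cong (bin (suc k) l *_) (ℤ.pos-* (suc k) (k ! ℕ.* l !)) ⟨
  bin (suc k) l * + (suc k ℕ.* (k ! ℕ.* l !))
    ≡⟨ cong (λ i → bin (suc k) l * + i) (ℕ.*-assoc (suc k) (k !) (l !)) ⟨
  bin (suc k) l * + (suc k ! ℕ.* l !)
    ≡⟨ bin-! (suc k) l ⟩
  + (suc (k ℕ.+ l) ℕ.* (k ℕ.+ l) !)
    ≡⟨ ℤ.pos-* (suc (k ℕ.+ l)) ((k ℕ.+ l) !) ⟩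
  + suc (k ℕ.+ l) * + ((k ℕ.+ l) !)
    ≡⟨ cong (+ suc (k ℕ.+ l) *_) (bin-! k l) ⟨
  + suc (k ℕ.+ l) * (bin k l * + (k ! ℕ.* l !))
    ≡⟨ reassoc (+ suc (k ℕ.+ l)) (bin k l) (+ (k ! ℕ.* l !)) ⟩
  bin k l * + suc (k ℕ.+ l) * + (k ! ℕ.* l !)
    ∎
  where
  open ≡-Reasoning
  reassoc : ∀ x y z → x * (y * z) ≡ y * x * z
  reassoc = solve-∀

bin-sucʳ : ∀ k l → bin k (suc l) * + suc l ≡ bin k l * + suc (k ℕ.+ l)
bin-sucʳ k l = begin
  bin k (suc l) * + suc l   ≡⟨ cong (_* + suc l) (bin-comm k (suc l)) ⟩
  bin (suc l) k * + suc l   ≡⟨ bin-sucˡ l k ⟩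
  bin l k * + suc (l ℕ.+ k)   ≡⟨ cong₂ (λ x i → x * + suc i) (bin-comm l k) (ℕ.+-comm l k) ⟩
  bin k l * + suc (k ℕ.+ l)   ∎
  where open ≡-Reasoning

bin-exchange : ∀ k l → bin (suc k) l * + suc k ≡ bin k (suc l) * + suc l
bin-exchange k l = trans (bin-sucˡ k l) (sym (bin-sucʳ k l))

bin-zeroʳ : ∀ k → bin k 0 ≡ 1ℤ
bin-zeroʳ k = bin-comm k 0

central : ℕ → ℤ
central k = bin k k

-- Two unit steps lead from (k, k) to (k + 1, k + 1). They produce the factor (2k + 1)(2k + 2) over
-- (k + 1)², of which one k + 1 cancels.
central-suc : ∀ k → central (suc k) * + suc k ≡ central k * (+ 2 * (+ 2 * + k + 1ℤ))
central-suc k = ℤ.*-cancelʳ-≡ _ _ (+ suc k) $ begin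
  central (suc k) * + suc k * + suc k
    ≡⟨ cong (_* + suc k) (bin-sucˡ k (suc k)) ⟩
  bin k (suc k) * + suc (k ℕ.+ suc k) * + suc k
    ≡⟨ swap (bin k (suc k)) (+ suc (k ℕ.+ suc k)) (+ suc k) ⟩
  bin k (suc k) * + suc k * + suc (k ℕ.+ suc k)
    ≡⟨ cong (_* + suc (k ℕ.+ suc k)) (bin-sucʳ k k) ⟩
  central k * + suc (k ℕ.+ k) * + suc (k ℕ.+ suc k)
    ≡⟨ arith (central k) (+ k) ⟩
  central k * (+ 2 * (+ 2 * + k + 1ℤ)) * + suc k
    ∎
  where
  open ≡-Reasoning
  swap : ∀ x y z → x * y * z ≡ x * z * y
  swap = solve-∀
  arith : ∀ c k → c * (1ℤ + (k + k)) * (1ℤ + (k + (1ℤ + k))) ≡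
                  c * (+ 2 * (+ 2 * k + 1ℤ)) * (1ℤ + k)
  arith = solve-∀

-- The sequences as sums, and the recurrence of S

summand : ℕ → ℕ → ℤ
summand k l = bin k l * (central k * central l)

s : ℕ → ℤ
s n = anti n summand

summand-comm : ∀ k l → summand k l ≡ summand l k
summand-comm k l = cong₂ _*_ (bin-comm k l) (ℤ.*-comm (central k) (central l))

summand-sucˡ : ∀ k l → + suc k * + suc k * summand (suc k) l ≡
                 + 2 * (+ 2 * + k + 1ℤ) * (1ℤ + (+ k + + l)) * summand k l
summand-sucˡ k l = begin
  + suc k * + suc k * summand (suc k) l
    ≡⟨ regroup (+ suc k) (bin (suc k) l) (central (suc k)) (central l) ⟩
  (bin (suc k) l * + suc k) * (central (suc k) * + suc k) * central l
    ≡⟨ cong₂ (λ x y → x * y * central l) (bin-sucˡ k l) (central-suc k) ⟩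
  (bin k l * + suc (k ℕ.+ l)) * (central k * (+ 2 * (+ 2 * + k + 1ℤ))) * central l
    ≡⟨ regroup′ (bin k l) (+ suc (k ℕ.+ l)) (central k) (+ 2 * (+ 2 * + k + 1ℤ)) (central l) ⟩
  + 2 * (+ 2 * + k + 1ℤ) * (1ℤ + (+ k + + l)) * summand k l
    ∎
  where
  open ≡-Reasoning
  regroup : ∀ x b c d → x * x * (b * (c * d)) ≡ (b * x) * (c * x) * d
  regroup = solve-∀
  regroup′ : ∀ b n c x d → (b * n) * (c * x) * d ≡ x * n * (b * (c * d))
  regroup′ = solve-∀

-- Weights are functions on ℤ, so that equal weights on the line `k + l = n` can be recognised by
-- polynomial identities.
moment : ℕ → (ℤ → ℤ → ℤ) → ℤ
moment n w = anti n (λ k l → w (+ k) (+ l) * summand k l)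

moment-cong : ∀ n {w v} → (∀ k l → k + l ≡ + n → w k l ≡ v k l) → moment n w ≡ moment n v
moment-cong n w≡v = anti-cong n λ k l eq →
  cong (_* summand k l) (w≡v (+ k) (+ l) (cong (λ i → + i) eq))

moment-+ : ∀ n w v → moment n (λ k l → w k l + v k l) ≡ moment n w + moment n v
moment-+ n w v = trans
  (anti-cong n λ k l _ → ℤ.*-distribʳ-+ (summand k l) (w (+ k) (+ l)) (v (+ k) (+ l)))
  (anti-+ n (λ k l → w (+ k) (+ l) * summand k l) (λ k l → v (+ k) (+ l) * summand k l))

moment-* : ∀ n c w → moment n (λ k l → c * w k l) ≡ c * moment n w
moment-* n c w = trans
  (anti-cong n λ k l _ → ℤ.*-assoc c (w (+ k) (+ l)) (summand k l))
  (anti-*ˡ n c (λ k l → w (+ k) (+ l) * summand k l))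

moment-flip : ∀ n w → moment n (flip w) ≡ moment n w
moment-flip n w = trans
  (anti-cong n λ k l _ → cong (_*_ (w (+ l) (+ k))) (summand-comm k l))
  (anti-flip n (λ k l → w (+ k) (+ l) * summand k l))

power : ℕ → ℕ → ℤ
power n i = moment n (λ k l → k ℤ.^ i)

moment-poly : ∀ n a b c → moment n (λ k l → a * k ℤ.^ 0 + (b * k ℤ.^ 1 + c * k ℤ.^ 2)) ≡
              a * power n 0 + (b * power n 1 + c * power n 2)
moment-poly n a b c = begin
  moment n (λ k l → a * k ℤ.^ 0 + (b * k ℤ.^ 1 + c * k ℤ.^ 2))
    ≡⟨ moment-+ n (λ k l → a * k ℤ.^ 0) (λ k l → b * k ℤ.^ 1 + c * k ℤ.^ 2) ⟩
  moment n (λ k l → a * k ℤ.^ 0) + moment n (λ k l → b * k ℤ.^ 1 + c * k ℤ.^ 2)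
    ≡⟨ cong₂ _+_ (moment-* n a (λ k l → k ℤ.^ 0))
         (trans (moment-+ n (λ k l → b * k ℤ.^ 1) (λ k l → c * k ℤ.^ 2))
           (cong₂ _+_ (moment-* n b (λ k l → k ℤ.^ 1)) (moment-* n c (λ k l → k ℤ.^ 2)))) ⟩
  a * power n 0 + (b * power n 1 + c * power n 2)
    ∎
  where open ≡-Reasoning

power-zero : ∀ n → power n 0 ≡ s n
power-zero n = anti-cong n λ k l _ → ℤ.*-identityˡ (summand k l)

power-one : ∀ n → + 2 * power n 1 ≡ + n * s n
power-one n = begin
  + 2 * power n 1
    ≡⟨ double (power n 1) ⟩
  power n 1 + power n 1
    ≡⟨ cong (_+_ (power n 1)) (moment-flip n (λ k l → k ℤ.^ 1)) ⟨
  power n 1 + moment n (λ k l → l ℤ.^ 1)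
    ≡⟨ moment-+ n (λ k l → k ℤ.^ 1) (λ k l → l ℤ.^ 1) ⟨
  moment n (λ k l → k ℤ.^ 1 + l ℤ.^ 1)
    ≡⟨ moment-cong n {v = λ k l → + n * k ℤ.^ 0} (λ k l eq → trans
         (cong₂ _+_ (ℤ.*-identityʳ k) (ℤ.*-identityʳ l)) (trans eq (sym (ℤ.*-identityʳ (+ n))))) ⟩
  moment n (λ k l → + n * k ℤ.^ 0)
    ≡⟨ moment-* n (+ n) (λ k l → k ℤ.^ 0) ⟩
  + n * power n 0
    ≡⟨ cong (_*_ (+ n)) (power-zero n) ⟩
  + n * s n
    ∎
  where
  open ≡-Reasoning
  double : ∀ x → + 2 * x ≡ x + x
  double = solve-∀

-- (k + 1)² summand(k + 1, l) = 2 (2k + 1) (k + l + 1) summand(k, l) lowers the index; together with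
-- the symmetry in k and l, which determines the odd moments, this gives the recurrence.
power-lower : ∀ n i → power (suc n) (suc (suc i)) ≡
  moment n (λ k l → (1ℤ + k) ℤ.^ i * (+ 2 * (+ 2 * k + 1ℤ) * (1ℤ + + n)))
power-lower n i = begin
  0ℤ * summand 0 (suc n) + anti n (λ k l → (+ suc k) ℤ.^ suc (suc i) * summand (suc k) l)
    ≡⟨ ℤ.+-identityˡ (anti n (λ k l → (+ suc k) ℤ.^ suc (suc i) * summand (suc k) l)) ⟩
  anti n (λ k l → (+ suc k) ℤ.^ suc (suc i) * summand (suc k) l)
    ≡⟨ anti-cong n (λ k l eq → begin
         + suc k * (+ suc k * (+ suc k) ℤ.^ i) * summand (suc k) l
           ≡⟨ regroup (+ suc k) ((+ suc k) ℤ.^ i) (summand (suc k) l) ⟩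
         (+ suc k) ℤ.^ i * (+ suc k * + suc k * summand (suc k) l)
           ≡⟨ cong (_*_ ((+ suc k) ℤ.^ i)) (summand-sucˡ k l) ⟩
         (+ suc k) ℤ.^ i * (+ 2 * (+ 2 * + k + 1ℤ) * (1ℤ + (+ k + + l)) * summand k l)
           ≡⟨ cong (λ j → (+ suc k) ℤ.^ i * (+ 2 * (+ 2 * + k + 1ℤ) * (1ℤ + + j) * summand k l)) eq ⟩
         (+ suc k) ℤ.^ i * (+ 2 * (+ 2 * + k + 1ℤ) * (1ℤ + + n) * summand k l)
           ≡⟨ ℤ.*-assoc ((+ suc k) ℤ.^ i) (+ 2 * (+ 2 * + k + 1ℤ) * (1ℤ + + n)) (summand k l) ⟨
         (+ suc k) ℤ.^ i * (+ 2 * (+ 2 * + k + 1ℤ) * (1ℤ + + n)) * summand k l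
           ∎) ⟩
  moment n (λ k l → (1ℤ + k) ℤ.^ i * (+ 2 * (+ 2 * k + 1ℤ) * (1ℤ + + n)))
    ∎
  where
  open ≡-Reasoning
  regroup : ∀ x y z → x * (x * y) * z ≡ y * (x * x * z)
  regroup = solve-∀

-- Lowering with `i = 0` leaves only the moments of order 0 and 1, both of which are known in terms
-- of `s n`.
power-two : ∀ n → power (suc n) 2 ≡ + 2 * (+ suc n * + suc n) * s n
power-two n = begin
  power (suc n) 2
    ≡⟨ power-lower n 0 ⟩
  moment n (λ k l → 1ℤ * (+ 2 * (+ 2 * k + 1ℤ) * (1ℤ + + n)))
    ≡⟨ moment-cong n (λ k l _ → expand k (1ℤ + + n)) ⟩
  moment n (λ k l → + 2 * + suc n * 1ℤ + (+ 4 * + suc n * (k * 1ℤ) + 0ℤ * (k * (k * 1ℤ))))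
    ≡⟨ moment-poly n (+ 2 * + suc n) (+ 4 * + suc n) 0ℤ ⟩
  + 2 * + suc n * power n 0 + (+ 4 * + suc n * power n 1 + 0ℤ * power n 2)
    ≡⟨ linear ((+ 2 * + suc n) ⊙ exact (power-zero n) ⊕ (+ 2 * + suc n) ⊙ exact (power-one n))
         (collect (+ n) (power n 0) (power n 1) (power n 2) (s n)) ⟩
  + 2 * (+ suc n * + suc n) * s n
    ∎
  where
  open ≡-Reasoning
  expand : ∀ k n → 1ℤ * (+ 2 * (+ 2 * k + 1ℤ) * n) ≡
                   + 2 * n * 1ℤ + (+ 4 * n * (k * 1ℤ) + 0ℤ * (k * (k * 1ℤ)))
  expand = solve-∀
  collect : ∀ n p₀ p₁ p₂ s →
    (+ 2 * (1ℤ + n) * p₀ + (+ 4 * (1ℤ + n) * p₁ + 0ℤ * p₂)) - + 2 * ((1ℤ + n) * (1ℤ + n)) * s ≡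
    + 2 * (1ℤ + n) * (p₀ - s) + + 2 * (1ℤ + n) * (+ 2 * p₁ - n * s)
  collect = solve-∀

power-three : ∀ n → power (suc n) 3 ≡ + 2 * + suc n * (s n + (+ 3 * power n 1 + + 2 * power n 2))
power-three n = begin
  power (suc n) 3
    ≡⟨ power-lower n 1 ⟩
  moment n (λ k l → (1ℤ + k) * 1ℤ * (+ 2 * (+ 2 * k + 1ℤ) * (1ℤ + + n)))
    ≡⟨ moment-cong n (λ k l _ → expand k (1ℤ + + n)) ⟩
  moment n (λ k l → + 2 * + suc n * 1ℤ + (+ 6 * + suc n * (k * 1ℤ) + + 4 * + suc n * (k * (k * 1ℤ))))
    ≡⟨ moment-poly n (+ 2 * + suc n) (+ 6 * + suc n) (+ 4 * + suc n) ⟩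
  + 2 * + suc n * power n 0 + (+ 6 * + suc n * power n 1 + + 4 * + suc n * power n 2)
    ≡⟨ linear ((+ 2 * + suc n) ⊙ exact (power-zero n))
         (collect (+ suc n) (power n 0) (power n 1) (power n 2) (s n)) ⟩
  + 2 * + suc n * (s n + (+ 3 * power n 1 + + 2 * power n 2))
    ∎
  where
  open ≡-Reasoning
  expand : ∀ k n → (1ℤ + k) * 1ℤ * (+ 2 * (+ 2 * k + 1ℤ) * n) ≡
                   + 2 * n * 1ℤ + (+ 6 * n * (k * 1ℤ) + + 4 * n * (k * (k * 1ℤ)))
  expand = solve-∀
  collect : ∀ n p₀ p₁ p₂ s →
    (+ 2 * n * p₀ + (+ 6 * n * p₁ + + 4 * n * p₂)) - + 2 * n * (s + (+ 3 * p₁ + + 2 * p₂)) ≡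
    + 2 * n * (p₀ - s)
  collect = solve-∀

-- From k³ + l³ = n³ − 3n²k + 3nk² for k + l = n.
power-three-sym : ∀ n → + 4 * power n 3 ≡ + 6 * + n * power n 2 - + n * + n * + n * s n
power-three-sym n = begin
  + 4 * power n 3
    ≡⟨ double (power n 3) ⟩
  + 2 * (power n 3 + power n 3)
    ≡⟨ cong (λ x → + 2 * (power n 3 + x)) (moment-flip n (λ k l → k ℤ.^ 3)) ⟨
  + 2 * (power n 3 + moment n (λ k l → l ℤ.^ 3))
    ≡⟨ cong (_*_ (+ 2)) (moment-+ n (λ k l → k ℤ.^ 3) (λ k l → l ℤ.^ 3)) ⟨
  + 2 * moment n (λ k l → k ℤ.^ 3 + l ℤ.^ 3)
    ≡⟨ cong (_*_ (+ 2)) (moment-cong n (λ k l eq → subst (λ n →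
         k ℤ.^ 3 + l ℤ.^ 3 ≡ n * n * n * 1ℤ + (- (+ 3 * n * n) * (k * 1ℤ) + + 3 * n * (k * (k * 1ℤ))))
         eq (expand k l))) ⟩
  + 2 * moment n (λ k l → + n * + n * + n * 1ℤ +
    (- (+ 3 * + n * + n) * (k * 1ℤ) + + 3 * + n * (k * (k * 1ℤ))))
    ≡⟨ cong (_*_ (+ 2)) (moment-poly n (+ n * + n * + n) (- (+ 3 * + n * + n)) (+ 3 * + n)) ⟩
  + 2 * (+ n * + n * + n * power n 0 + (- (+ 3 * + n * + n) * power n 1 + + 3 * + n * power n 2))
    ≡⟨ linear ((+ 2 * + n * + n * + n) ⊙ exact (power-zero n) ⊕ (- (+ 3 * + n * + n)) ⊙ exact (power-one n))
         (collect (+ n) (power n 0) (power n 1) (power n 2) (s n)) ⟩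
  + 6 * + n * power n 2 - + n * + n * + n * s n
    ∎
  where
  open ≡-Reasoning
  double : ∀ x → + 4 * x ≡ + 2 * (x + x)
  double = solve-∀
  expand : ∀ k l → k * (k * (k * 1ℤ)) + l * (l * (l * 1ℤ)) ≡
    (k + l) * (k + l) * (k + l) * 1ℤ +
    (- (+ 3 * (k + l) * (k + l)) * (k * 1ℤ) + + 3 * (k + l) * (k * (k * 1ℤ)))
  expand = solve-∀
  collect : ∀ n p₀ p₁ p₂ s →
    + 2 * (n * n * n * p₀ + (- (+ 3 * n * n) * p₁ + + 3 * n * p₂)) - (+ 6 * n * p₂ - n * n * n * s) ≡
    + 2 * n * n * n * (p₀ - s) + - (+ 3 * n * n) * (+ 2 * p₁ - n * s)
  collect = solve-∀

-- At `n = 0` both sides are 0, whatever the value of `s (0 ∸ 1)`; hence `s-recurrence` holds from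
-- `n = 0` on.
power-two′ : ∀ n → power n 2 ≡ + 2 * (+ n * + n) * s (n ∸ 1)
power-two′ zero    = refl
power-two′ (suc n) = power-two n

-- The third moment at `suc n` is evaluated twice, by symmetry and by lowering the index.
-- Eliminating the other moments leaves the recurrence times `suc n`, which is cancelled.
s-recurrence : ∀ n → + suc n * + suc n * s (suc n) ≡
  + 4 * (+ 3 * + n * + n + + 3 * + n + 1ℤ) * s n - + 32 * + n * + n * s (n ∸ 1)
s-recurrence n = ℤ.*-cancelˡ-≡ (+ suc n) _ _ $ linear
  (1ℤ ⊙ exact (power-three-sym (suc n)) ⊕ (- + 4) ⊙ exact (power-three n) ⊕
   (+ 6 * + suc n) ⊙ exact (power-two n) ⊕ (- + 12 * + suc n) ⊙ exact (power-one n) ⊕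
   (- + 16 * + suc n) ⊙ exact (power-two′ n))
  (collect (+ n) (power (suc n) 3) (power (suc n) 2) (power n 1) (power n 2) (s (suc n)) (s n) (s (n ∸ 1)))
  where
  collect : ∀ n q₃ q₂ p₁ p₂ s⁺ s s⁻ →
    (1ℤ + n) * ((1ℤ + n) * (1ℤ + n) * s⁺) -
    (1ℤ + n) * (+ 4 * (+ 3 * n * n + + 3 * n + 1ℤ) * s - + 32 * n * n * s⁻) ≡
    1ℤ * (+ 4 * q₃ - (+ 6 * (1ℤ + n) * q₂ - (1ℤ + n) * (1ℤ + n) * (1ℤ + n) * s⁺)) +
    (- + 4) * (q₃ - + 2 * (1ℤ + n) * (s + (+ 3 * p₁ + + 2 * p₂))) +
    (+ 6 * (1ℤ + n)) * (q₂ - + 2 * ((1ℤ + n) * (1ℤ + n)) * s) +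
    (- + 12 * (1ℤ + n)) * (+ 2 * p₁ - n * s) +
    (- + 16 * (1ℤ + n)) * (p₂ - + 2 * (n * n) * s⁻)
  collect = solve-∀

s-unique : ∀ S → IsSSequence S → ∀ n → S n ≡ s n
s-unique S isS = proj₁ ∘ both
  where
  open IsSSequence isS
  recur : ∀ n → + suc (suc n) * + suc (suc n) * S (suc (suc n)) ≡
    + 4 * (+ 3 * + suc n * + suc n + + 3 * + suc n + 1ℤ) * S (suc n) - + 32 * + suc n * + suc n * S n
  recur n = begin
    + suc (suc n) * + suc (suc n) * S (suc (suc n))
      ≡⟨ cong (_* S (suc (suc n)))
         (trans (sym (ℤ.pos-* (suc (suc n)) (suc (suc n)))) (cong (λ i → + i) (square₁ n))) ⟩
    + ((suc n ℕ.+ 1) ^ 2) * S (suc (suc n))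
      ≡⟨ cong (λ i → + ((suc n ℕ.+ 1) ^ 2) * S i) (ℕ.+-comm 1 (suc n)) ⟩
    + ((suc n ℕ.+ 1) ^ 2) * S (suc n ℕ.+ 1)
      ≡⟨ recurrence (suc n) (s≤s z≤n) ⟩
    + (4 ℕ.* (3 ℕ.* suc n ^ 2 ℕ.+ 3 ℕ.* suc n ℕ.+ 1)) * S (suc n) - + (32 ℕ.* suc n ^ 2) * S n
      ≡⟨ cong₂ (λ x y → x * S (suc n) - y * S n) (quadratic (suc n)) (square (suc n)) ⟩
    + 4 * (+ 3 * + suc n * + suc n + + 3 * + suc n + 1ℤ) * S (suc n) - + 32 * + suc n * + suc n * S n
      ∎
    where
    open ≡-Reasoning
    square₁ : ∀ n → suc (suc n) ℕ.* suc (suc n) ≡ (suc n ℕ.+ 1) ^ 2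
    square₁ n = trans (cong (λ i → i ℕ.* i) (ℕ.+-comm 1 (suc n)))
      (cong ((suc n ℕ.+ 1) ℕ.*_) (sym (ℕ.*-identityʳ (suc n ℕ.+ 1))))
    pos-square : ∀ n → + (n ^ 2) ≡ + n * + n
    pos-square n = trans (cong (λ i → + (n ℕ.* i)) (ℕ.*-identityʳ n)) (ℤ.pos-* n n)
    square : ∀ n → + (32 ℕ.* n ^ 2) ≡ + 32 * + n * + n
    square n = trans (ℤ.pos-* 32 (n ^ 2))
      (trans (cong (_*_ (+ 32)) (pos-square n)) (sym (ℤ.*-assoc (+ 32) (+ n) (+ n))))
    quadratic : ∀ n → + (4 ℕ.* (3 ℕ.* n ^ 2 ℕ.+ 3 ℕ.* n ℕ.+ 1)) ≡ + 4 * (+ 3 * + n * + n + + 3 * + n + 1ℤ)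
    quadratic n = trans (ℤ.pos-* 4 (3 ℕ.* n ^ 2 ℕ.+ 3 ℕ.* n ℕ.+ 1)) (cong (_*_ (+ 4))
      (cong₂ (λ x y → x + y + 1ℤ)
        (trans (ℤ.pos-* 3 (n ^ 2))
          (trans (cong (_*_ (+ 3)) (pos-square n)) (sym (ℤ.*-assoc (+ 3) (+ n) (+ n)))))
        (ℤ.pos-* 3 n)))
  both : ∀ n → S n ≡ s n × S (suc n) ≡ s (suc n)
  both zero    = S₀ , S₁
  both (suc n) with both n
  ... | eq₀ , eq₁ = eq₁ , ℤ.*-cancelˡ-≡ (+ suc (suc n) * + suc (suc n)) _ _
    (trans (recur n) (trans
      (cong₂ (λ x y → + 4 * (+ 3 * + suc n * + suc n + + 3 * + suc n + 1ℤ) * x -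
                      + 32 * + suc n * + suc n * y) eq₁ eq₀)
      (sym (s-recurrence (suc n)))))

cube : ℕ → ℕ → ℤ
cube k l = bin k l * (bin k l * bin k l)

sum-applyUpTo : ∀ n F g → (∀ k l → k ℕ.+ l ≡ n → + F k ≡ g k l) → + sum (applyUpTo F (suc n)) ≡ anti n g
sum-applyUpTo zero    F g F≡g = trans (cong (λ i → + i) (ℕ.+-identityʳ (F 0))) (F≡g 0 0 refl)
sum-applyUpTo (suc n) F g F≡g =
  cong₂ _+_ (F≡g 0 (suc n) refl)
    (sum-applyUpTo n (F ∘ suc) (g ∘ suc) (λ k l eq → F≡g (suc k) l (cong suc eq)))

franel≡cubes : ∀ n → + franel n ≡ anti n cube
franel≡cubes n = trans (cong (λ xs → + sum xs) (map-upTo (λ k → (n C k) ^ 3) (suc n)))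
  (sum-applyUpTo n (λ k → (n C k) ^ 3) cube
    (λ k l eq → subst (λ n → + ((n C k) ^ 3) ≡ cube k l) eq (pos-cube ((k ℕ.+ l) C k))))
  where
  pos-cube : ∀ x → + (x ^ 3) ≡ + x * (+ x * + x)
  pos-cube x = trans (cong (λ i → + (x ℕ.* (x ℕ.* i))) (ℕ.*-identityʳ x))
    (trans (ℤ.pos-* x (x ℕ.* x)) (cong (_*_ (+ x)) (ℤ.pos-* x x)))

-- Binomial coefficients modulo p²

module Prime-mod (q : ℕ) (p-prime : Prime (suc q)) where

  p : ℕ
  p = suc q

  P : ℤ
  P = + p

  P∣P² : P ∣ₛ P * P
  P∣P² = divides P refl

  invertible : ∀ u → suc u < p → Invertible (P * P) (+ suc u)
  invertible u u<p = invertible-square (prime⇒invertible p-prime u u<p)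

  invertible-! : ∀ n → n < p → Invertible P (+ (n !))
  invertible-! zero    _   = has-inverse 1ℤ mod-refl
  invertible-! (suc n) n<p = subst (Invertible P) (sym (ℤ.pos-* (suc n) (n !)))
    (invertible-* (prime⇒invertible p-prime n n<p) (invertible-! n (ℕ.<-trans ℕ.≤-refl n<p)))

  -- Dependence on the leading base-p digits a, a′ to first order in p.
  record Affine (w g : ℕ → ℕ → ℤ) : Set where
    field
      value slopeˡ slopeʳ : ℤ
      expansion : ∀ a a′ →
        g a a′ ≡ w a a′ * (value + P * (+ a * slopeˡ + + a′ * slopeʳ)) [mod P * P ]

  open Affine

  one : ℕ → ℕ → ℤ
  one _ _ = 1ℤ

  affine-refl : ∀ w → Affine w w
  affine-refl w = record
    { value = 1ℤ ; slopeˡ = 0ℤ ; slopeʳ = 0ℤ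
    ; expansion = λ a a′ → exact (identity (w a a′) P (+ a) (+ a′)) }
    where
    identity : ∀ w p a a′ → w ≡ w * (1ℤ + p * (a * 0ℤ + a′ * 0ℤ))
    identity = solve-∀

  affine-resp : ∀ {w g g′ w′} → (∀ a a′ → w a a′ ≡ w′ a a′) →
                (∀ a a′ → g′ a a′ ≡ g a a′ [mod P * P ]) → Affine w g → Affine w′ g′
  affine-resp {w} {w′ = w′} w≡w′ g′≡g A = record
    { value = value A ; slopeˡ = slopeˡ A ; slopeʳ = slopeʳ A
    ; expansion = λ a a′ → mod-trans (g′≡g a a′)
        (mod-trans (expansion A a a′)
          (exact (cong (_* (value A + P * (+ a * slopeˡ A + + a′ * slopeʳ A))) (w≡w′ a a′)))) }

  affine-+ : ∀ {w g g′} → Affine w g → Affine w g′ → Affine w (λ a a′ → g a a′ + g′ a a′)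
  affine-+ {w} A B = record
    { value = value A + value B
    ; slopeˡ = slopeˡ A + slopeˡ B
    ; slopeʳ = slopeʳ A + slopeʳ B
    ; expansion = λ a a′ → mod-trans (mod-+ (expansion A a a′) (expansion B a a′))
        (exact (collect (w a a′) P (+ a) (+ a′)
                  (value A) (slopeˡ A) (slopeʳ A) (value B) (slopeˡ B) (slopeʳ B))) }
    where
    collect : ∀ w p a a′ u v v′ x y y′ →
      w * (u + p * (a * v + a′ * v′)) + w * (x + p * (a * y + a′ * y′)) ≡
      w * (u + x + p * (a * (v + y) + a′ * (v′ + y′)))
    collect = solve-∀

  affine-* : ∀ {w w′ g g′} → Affine w g → Affine w′ g′ →
             Affine (λ a a′ → w a a′ * w′ a a′) (λ a a′ → g a a′ * g′ a a′)
  affine-* {w} {w′} A B = record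
    { value  = value A * value B
    ; slopeˡ = value A * slopeˡ B + value B * slopeˡ A
    ; slopeʳ = value A * slopeʳ B + value B * slopeʳ A
    ; expansion = λ a a′ → mod-trans (mod-* (expansion A a a′) (expansion B a a′))
        (mod-linear
          -- The product of the two first-order terms carries `P * P`.
          ((w a a′ * w′ a a′ * ((+ a * slopeˡ A + + a′ * slopeʳ A) * (+ a * slopeˡ B + + a′ * slopeʳ B)))
            ⊙ mod-self)
          (collect (w a a′) (w′ a a′) P (+ a) (+ a′)
                   (value A) (slopeˡ A) (slopeʳ A) (value B) (slopeˡ B) (slopeʳ B))) }
    where
    collect : ∀ w w′ p a a′ u v v′ x y y′ →
      w * (u + p * (a * v + a′ * v′)) * (w′ * (x + p * (a * y + a′ * y′))) -
      w * w′ * (u * x + p * (a * (u * y + x * v) + a′ * (u * y′ + x * v′))) ≡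
      w * w′ * ((a * v + a′ * v′) * (a * y + a′ * y′)) * (p * p - 0ℤ)
    collect = solve-∀

  -- If e inverts u, then (u + p y)⁻¹ ≡ e - p e² y modulo p², which is again of first order in p.
  affine-inverse : ∀ {g} (A : Affine one g) → Invertible (P * P) (value A) →
    ∃ λ g⁻¹ → Affine one g⁻¹ × (∀ a a′ → g a a′ * g⁻¹ a a′ ≡ 1ℤ [mod P * P ])
  affine-inverse {g} A (has-inverse e ue≡1) = g⁻¹ ,
    record { value = e ; slopeˡ = - (e * e * slopeˡ A) ; slopeʳ = - (e * e * slopeʳ A)
           ; expansion = λ a a′ → exact (unfold P e (+ a) (+ a′) (slopeˡ A) (slopeʳ A)) } ,
    λ a a′ → mod-linear
      (g⁻¹ a a′ ⊙ expansion A a a′ ⊕ (1ℤ - P * e * y a a′) ⊙ ue≡1 ⊕ (- (e * e * y a a′ * y a a′)) ⊙ mod-self)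
      (complete (g a a′) P e (value A) (y a a′))
    where
    y : ℕ → ℕ → ℤ
    y a a′ = + a * slopeˡ A + + a′ * slopeʳ A
    g⁻¹ : ℕ → ℕ → ℤ
    g⁻¹ a a′ = e - P * (e * e * y a a′)
    unfold : ∀ p e a a′ v v′ → e - p * (e * e * (a * v + a′ * v′)) ≡
             1ℤ * (e + p * (a * - (e * e * v) + a′ * - (e * e * v′)))
    unfold = solve-∀
    complete : ∀ g p e u y → g * (e - p * (e * e * y)) - 1ℤ ≡
      (e - p * (e * e * y)) * (g - 1ℤ * (u + p * y)) +
      (1ℤ - p * e * y) * (u * e - 1ℤ) +
      (- (e * e * y * y)) * (p * p - 0ℤ)
    complete = solve-∀

  -- This passes expansions along the unit steps `bin-sucˡ` and `bin-sucʳ`, where `h` is the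
  -- denominator and `k` the numerator of the ratio.
  affine-quotient : ∀ {w g g′ h k} → Affine w g → (H : Affine one h) → Affine one k →
    Invertible (P * P) (value H) → (∀ a a′ → g′ a a′ * h a a′ ≡ g a a′ * k a a′) → Affine w g′
  affine-quotient {w} {g} {g′} {h} {k} G H K inv g′h≡gk =
    let h⁻¹ , H⁻¹ , hh⁻¹≡1 = affine-inverse H inv in affine-resp
    {w = λ a a′ → w a a′ * (1ℤ * 1ℤ)} {g = λ a a′ → g a a′ * (k a a′ * h⁻¹ a a′)} {g′}
    (λ a a′ → identity (w a a′))
    (λ a a′ → mod-linear (h⁻¹ a a′ ⊙ exact (g′h≡gk a a′) ⊕ (- g′ a a′) ⊙ hh⁻¹≡1 a a′)
       (divide (g′ a a′) (g a a′) (h a a′) (k a a′) (h⁻¹ a a′)))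
    (affine-* {w} {λ _ _ → 1ℤ * 1ℤ} G (affine-* {one} {one} K H⁻¹))
    where
    identity : ∀ w → w * (1ℤ * 1ℤ) ≡ w
    identity = solve-∀
    divide : ∀ g′ g h k i → g′ - g * (k * i) ≡ i * (g′ * h - g * k) + - g′ * (h * i - 1ℤ)
    divide = solve-∀

  affine-anti : ∀ {w} n {g : ℕ → ℕ → ℕ → ℕ → ℤ} → (∀ b b′ → b ℕ.+ b′ ≡ n → Affine w (g b b′)) →
                Affine w (λ a a′ → anti n (λ b b′ → g b b′ a a′))
  affine-anti zero    A = A 0 0 refl
  affine-anti (suc n) A =
    affine-+ (A 0 (suc n) refl) (affine-anti n (λ b b′ eq → A (suc b) b′ (cong suc eq)))

  affine-digit : ∀ b → Affine one (λ a a′ → + (b ℕ.+ a ℕ.* p))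
  affine-digit b = record
    { value = + b ; slopeˡ = 1ℤ ; slopeʳ = 0ℤ
    ; expansion = λ a a′ → exact (trans (cong (_+_ (+ b)) (ℤ.pos-* a p)) (rearrange (+ b) (+ a) (+ a′) P)) }
    where
    rearrange : ∀ b a a′ p → b + a * p ≡ 1ℤ * (b + p * (a * 1ℤ + a′ * 0ℤ))
    rearrange = solve-∀

  affine-digitʳ : ∀ b → Affine one (λ a a′ → + (b ℕ.+ a′ ℕ.* p))
  affine-digitʳ b = record
    { value = + b ; slopeˡ = 0ℤ ; slopeʳ = 1ℤ
    ; expansion = λ a a′ → exact (trans (cong (_+_ (+ b)) (ℤ.pos-* a′ p)) (rearrange (+ b) (+ a) (+ a′) P)) }
    where
    rearrange : ∀ b a a′ p → b + a′ * p ≡ 1ℤ * (b + p * (a * 0ℤ + a′ * 1ℤ))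
    rearrange = solve-∀

  -- A refinement of Lucas' factorization to the modulus p²: splitting off the last digits leaves a
  -- factor that is affine in the leading ones.
  Digits : (ℕ → ℕ → ℤ) → ℕ → ℕ → Set
  Digits f b b′ = Affine (λ a a′ → f (a ℕ.* p) (a′ ℕ.* p))
                         (λ a a′ → f (b ℕ.+ a ℕ.* p) (b′ ℕ.+ a′ ℕ.* p))

  -- The last digits are built up one unit at a time. Each denominator has a last digit strictly
  -- between 0 and p, so it is a unit; the numerators may be divisible by p.
  digits-bin : ∀ b b′ → b < p → b′ < p → Digits bin b b′
  digits-bin zero    zero     _   _    = affine-refl _
  digits-bin zero    (suc b′) b<p b′<p =
    affine-quotient (digits-bin zero b′ b<p (ℕ.<-trans ℕ.≤-refl b′<p))
      (affine-digitʳ (suc b′)) (affine-+ (affine-digit 0) (affine-digitʳ (suc b′)))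
      (invertible b′ b′<p)
      (λ a a′ → trans (bin-sucʳ (a ℕ.* p) (b′ ℕ.+ a′ ℕ.* p))
        (cong (λ i → bin (a ℕ.* p) (b′ ℕ.+ a′ ℕ.* p) * + i) (sym (ℕ.+-suc (a ℕ.* p) (b′ ℕ.+ a′ ℕ.* p)))))
  digits-bin (suc b) b′       b<p b′<p =
    affine-quotient (digits-bin b b′ (ℕ.<-trans ℕ.≤-refl b<p) b′<p)
      (affine-digit (suc b)) (affine-+ (affine-digit (suc b)) (affine-digitʳ b′))
      (invertible b b<p)
      (λ a a′ → bin-sucˡ (b ℕ.+ a ℕ.* p) (b′ ℕ.+ a′ ℕ.* p))

  digits-diagonal : ∀ f b b′ → Digits f b b → Digits (λ k l → f k k) b b′
  digits-diagonal f b b′ A = record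
    { value = value A ; slopeˡ = slopeˡ A + slopeʳ A ; slopeʳ = 0ℤ
    ; expansion = λ a a′ → mod-trans (expansion A a a)
        (exact (collect (f (a ℕ.* p) (a ℕ.* p)) (value A) P (+ a) (+ a′) (slopeˡ A) (slopeʳ A))) }
    where
    collect : ∀ w u p a a′ v v′ → w * (u + p * (a * v + a * v′)) ≡
                                  w * (u + p * (a * (v + v′) + a′ * 0ℤ))
    collect = solve-∀

  digits-flip : ∀ f b b′ → Digits f b b′ → Digits (flip f) b′ b
  digits-flip f b b′ A = record
    { value = value A ; slopeˡ = slopeʳ A ; slopeʳ = slopeˡ A
    ; expansion = λ a a′ → mod-trans (expansion A a′ a)
        (exact (cong (λ x → f (a′ ℕ.* p) (a ℕ.* p) * (value A + P * x))
          (ℤ.+-comm (+ a′ * slopeˡ A) (+ a * slopeʳ A)))) }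

  -- Modulo p the slopes disappear, and the case `a = a′ = 0` identifies the remaining constant
  -- `value A` with `f b b′`.
  digits-lucas : ∀ f b b′ → f 0 0 ≡ 1ℤ → Digits f b b′ → ∀ a a′ →
    f (b ℕ.+ a ℕ.* p) (b′ ℕ.+ a′ ℕ.* p) ≡ f (a ℕ.* p) (a′ ℕ.* p) * f b b′ [mod P ]
  digits-lucas f b b′ f₀≡1 A a a′ = begin
    f (b ℕ.+ a ℕ.* p) (b′ ℕ.+ a′ ℕ.* p)  ≈⟨ leading a a′ ⟩
    f (a ℕ.* p) (a′ ℕ.* p) * value A     ≈⟨ mod-*ˡ (f (a ℕ.* p) (a′ ℕ.* p)) (leading-zero) ⟨
    f (a ℕ.* p) (a′ ℕ.* p) * f b b′      ∎
    where
    open mod-Reasoning P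
    drop : ∀ w u p x → w * (u + p * x) - w * u ≡ w * x * (p - 0ℤ)
    drop = solve-∀
    leading : ∀ a a′ → f (b ℕ.+ a ℕ.* p) (b′ ℕ.+ a′ ℕ.* p) ≡ f (a ℕ.* p) (a′ ℕ.* p) * value A [mod P ]
    leading a a′ = mod-trans (mod-weaken P∣P² (expansion A a a′))
      (mod-linear ((f (a ℕ.* p) (a′ ℕ.* p) * (+ a * slopeˡ A + + a′ * slopeʳ A)) ⊙ mod-self)
        (drop (f (a ℕ.* p) (a′ ℕ.* p)) (value A) P (+ a * slopeˡ A + + a′ * slopeʳ A)))
    leading-zero : f b b′ ≡ value A [mod P ]
    leading-zero = begin
      f b b′                    ≡⟨ cong₂ f (ℕ.+-identityʳ b) (ℕ.+-identityʳ b′) ⟨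
      f (b ℕ.+ 0) (b′ ℕ.+ 0)    ≈⟨ leading 0 0 ⟩
      f 0 0 * value A           ≡⟨ cong (_* value A) f₀≡1 ⟩
      1ℤ * value A              ≡⟨ ℤ.*-identityˡ (value A) ⟩
      value A                   ∎

  -- p divides (b + b′)! but neither b! nor b′!.
  bin-carry : ∀ b b′ → b < p → b′ < p → p ≤ b ℕ.+ b′ → bin b b′ ≡ 0ℤ [mod P ]
  bin-carry b b′ b<p b′<p p≤b+b′ = mod-cancel {u = + (b !) * + (b′ !)}
    (invertible-* (invertible-! b b<p) (invertible-! b′ b′<p)) (begin
      + (b !) * + (b′ !) * bin b b′    ≡⟨ eq ⟩
      + ((b ℕ.+ b′) !)                 ≈⟨ [b+b′]!≡0 ⟩
      0ℤ                               ≡⟨ ℤ.*-zeroʳ (+ (b !) * + (b′ !)) ⟨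
      + (b !) * + (b′ !) * 0ℤ          ∎)
    where
    open mod-Reasoning P
    [b+b′]!≡0 : + ((b ℕ.+ b′) !) ≡ 0ℤ [mod P ]
    [b+b′]!≡0 = congruent (subst (P ∣ₛ_) (sym (ℤ.+-identityʳ (+ ((b ℕ.+ b′) !))))
      (∣ᵤ⇒∣ (∣-trans (m∣m*n (q !)) (m≤n⇒m!∣n! p≤b+b′))))
    eq : + (b !) * + (b′ !) * bin b b′ ≡ + ((b ℕ.+ b′) !)
    eq = trans (cong (_* bin b b′) (sym (ℤ.pos-* (b !) (b′ !))))
           (trans (ℤ.*-comm (+ (b ! ℕ.* b′ !)) (bin b b′)) (bin-! b b′))

  bin-carry-digits : ∀ b b′ → b < p → b′ < p → p ≤ b ℕ.+ b′ → ∀ a a′ →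
    bin (b ℕ.+ a ℕ.* p) (b′ ℕ.+ a′ ℕ.* p) ≡ 0ℤ [mod P ]
  bin-carry-digits b b′ b<p b′<p p≤b+b′ a a′ = mod-trans
    (digits-lucas bin b b′ refl (digits-bin b b′ b<p b′<p) a a′)
    (mod-trans (mod-*ˡ (bin (a ℕ.* p) (a′ ℕ.* p)) (bin-carry b b′ b<p b′<p p≤b+b′))
               (exact (ℤ.*-zeroʳ (bin (a ℕ.* p) (a′ ℕ.* p)))))

  -- One step down from `suc a * p` gives the last digit `q = p - 1`, which contributes
  -- `bin q 0 = 1`; what remains is the unit step for `bin a a′`.
  bin-lucas : ∀ a a′ → a < p → bin (a ℕ.* p) (a′ ℕ.* p) ≡ bin a a′ [mod P ]
  bin-lucas zero    a′ _   = mod-refl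
  bin-lucas (suc a) a′ a<p = mod-cancel {u = + suc a} (prime⇒invertible p-prime a a<p) (begin
    + suc a * bin (suc a ℕ.* p) (a′ ℕ.* p)
      ≡⟨ ℤ.*-cancelʳ-≡ _ _ P step ⟩
    bin (q ℕ.+ a ℕ.* p) (a′ ℕ.* p) * (+ suc a + + a′)
      ≈⟨ mod-* (digits-lucas bin q 0 refl (digits-bin q 0 ℕ.≤-refl (s≤s z≤n)) a a′)
               (mod-refl {x = + suc a + + a′}) ⟩
    bin (a ℕ.* p) (a′ ℕ.* p) * bin q 0 * (+ suc a + + a′)
      ≈⟨ mod-* (mod-* (bin-lucas a a′ (ℕ.<-trans ℕ.≤-refl a<p)) (exact (bin-zeroʳ q)))
               (mod-refl {x = + suc a + + a′}) ⟩
    bin a a′ * 1ℤ * (+ suc a + + a′)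
      ≡⟨ cong (_* (+ suc a + + a′)) (ℤ.*-identityʳ (bin a a′)) ⟩
    bin a a′ * + suc (a ℕ.+ a′)
      ≡⟨ bin-sucˡ a a′ ⟨
    bin (suc a) a′ * + suc a
      ≡⟨ ℤ.*-comm (bin (suc a) a′) (+ suc a) ⟩
    + suc a * bin (suc a) a′
      ∎)
    where
    open mod-Reasoning P
    reassoc : ∀ x y z → x * y * z ≡ y * (x * z)
    reassoc = solve-∀
    distrib : ∀ b x y z → b * (x * z + y * z) ≡ b * (x + y) * z
    distrib = solve-∀
    -- Both factors of the unit step are multiples of p; this common factor has to be cancelled over
    -- ℤ before reducing modulo p.
    step : + suc a * bin (suc a ℕ.* p) (a′ ℕ.* p) * P ≡
           bin (q ℕ.+ a ℕ.* p) (a′ ℕ.* p) * (+ suc a + + a′) * P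
    step = trans (reassoc (+ suc a) (bin (suc a ℕ.* p) (a′ ℕ.* p)) P)
      (trans (cong (_*_ (bin (suc a ℕ.* p) (a′ ℕ.* p))) (sym (ℤ.pos-* (suc a) p)))
      (trans (bin-sucˡ (q ℕ.+ a ℕ.* p) (a′ ℕ.* p))
      (trans (cong (_*_ (bin (q ℕ.+ a ℕ.* p) (a′ ℕ.* p)))
               (cong₂ _+_ (ℤ.pos-* (suc a) p) (ℤ.pos-* a′ p)))
             (distrib (bin (q ℕ.+ a ℕ.* p) (a′ ℕ.* p)) (+ suc a) (+ a′) P))))

-- Reduction from p² to p

module Half (h : ℕ) (p-prime : Prime (suc (suc h ℕ.+ suc h))) where

  -- Here p = 2m + 1 with m positive. Its predecessor `h` is the bound for `k` when the digits m +
  -- 1, ..., p - 1 are written `k + suc m`.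
  m : ℕ
  m = suc h

  open Prime-mod (m ℕ.+ m) p-prime
  open Affine

  -- Induction on `a`, cutting by the first index: up to m its leading digit is 0; from m + 1 to p -
  -- 1 both last digits exceed m and the terms vanish; from p on, a shift by p leads to the case of
  -- smaller `a`.
  digit-split : ∀ {N} a f →
    (∀ i j k l → k ℕ.+ l ≡ h →
      f (k ℕ.+ suc m ℕ.+ i ℕ.* p) (l ℕ.+ suc m ℕ.+ j ℕ.* p) ≡ 0ℤ [mod N ]) →
    anti (m ℕ.+ a ℕ.* p) f ≡
    anti a (λ i j → anti m (λ k l → f (k ℕ.+ i ℕ.* p) (l ℕ.+ j ℕ.* p))) [mod N ]
  digit-split zero    f carry = exact $ begin
    anti (m ℕ.+ 0) f
      ≡⟨ cong (λ n → anti n f) (ℕ.+-identityʳ m) ⟩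
    anti m f
      ≡⟨ anti-cong m (λ k l _ → cong₂ f (ℕ.+-identityʳ k) (ℕ.+-identityʳ l)) ⟨
    anti m (λ k l → f (k ℕ.+ 0) (l ℕ.+ 0))
      ∎
    where open ≡-Reasoning
  digit-split {N} (suc a) f carry = begin
    anti (m ℕ.+ suc a ℕ.* p) f
      ≡⟨ anti-split m (m ℕ.+ m ℕ.+ a ℕ.* p) f ⟩
    anti m (λ k l → f k (l ℕ.+ suc a ℕ.* p)) + anti (m ℕ.+ m ℕ.+ a ℕ.* p) shifted
      ≡⟨ cong₂ _+_
           (anti-cong m (λ k l _ → cong (λ i → f i (l ℕ.+ suc a ℕ.* p)) (sym (ℕ.+-identityʳ k))))
           (trans (cong (λ n → anti n shifted) position) (anti-split h (m ℕ.+ a ℕ.* p) shifted)) ⟩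
    first + (anti h (λ k l → shifted k (l ℕ.+ suc (m ℕ.+ a ℕ.* p))) +
             anti (m ℕ.+ a ℕ.* p) (λ k l → shifted (k ℕ.+ m) l))
      ≈⟨ mod-+ (mod-refl {x = first}) (mod-+
           (anti-vanish h (λ k l eq → subst₂ (λ i j → f i j ≡ 0ℤ [mod N ])
             (ℕ.+-identityʳ (k ℕ.+ suc m)) (ℕ.+-assoc l (suc m) (a ℕ.* p)) (carry 0 a k l eq)))
           (mod-trans
             (exact (anti-cong (m ℕ.+ a ℕ.* p) (λ k l _ → cong (λ i → f i l) (ℕ.+-assoc k m (suc m)))))
             (digit-split a (λ k l → f (k ℕ.+ (m ℕ.+ suc m)) l) (λ i j k l eq →
               subst (λ x → f x (l ℕ.+ suc m ℕ.+ j ℕ.* p) ≡ 0ℤ [mod N ])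
                 (next (k ℕ.+ suc m) (i ℕ.* p)) (carry (suc i) j k l eq))))) ⟩
    first + (0ℤ + anti a (λ i j → anti m (λ k l → f (k ℕ.+ i ℕ.* p ℕ.+ (m ℕ.+ suc m)) (l ℕ.+ j ℕ.* p))))
      ≡⟨ cong (_+_ first) (trans (ℤ.+-identityˡ _)
           (anti-cong a (λ i j _ → anti-cong m (λ k l _ →
             cong (λ x → f x (l ℕ.+ j ℕ.* p)) (sym (next k (i ℕ.* p))))))) ⟩
    anti (suc a) (λ i j → anti m (λ k l → f (k ℕ.+ i ℕ.* p) (l ℕ.+ j ℕ.* p)))
      ∎
    where
    open mod-Reasoning N
    shifted : ℕ → ℕ → ℤ
    shifted k l = f (k ℕ.+ suc m) l
    first : ℤ
    first = anti m (λ k l → f (k ℕ.+ 0) (l ℕ.+ suc a ℕ.* p))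
    position : m ℕ.+ m ℕ.+ a ℕ.* p ≡ h ℕ.+ suc (m ℕ.+ a ℕ.* p)
    position = trans (ℕ.+-assoc m m (a ℕ.* p)) (sym (ℕ.+-suc h (m ℕ.+ a ℕ.* p)))
    next : ∀ k x → k ℕ.+ (p ℕ.+ x) ≡ k ℕ.+ x ℕ.+ (m ℕ.+ suc m)
    next k x = trans (cong (k ℕ.+_) (trans (ℕ.+-comm p x) (cong (x ℕ.+_) (sym (ℕ.+-suc m m)))))
                     (sym (ℕ.+-assoc k x (m ℕ.+ suc m)))

  2<p : 2 < p
  2<p = s≤s (s≤s (ℕ.≤-trans (s≤s z≤n) (ℕ.m≤n+m m h)))

  -- For k + l = m + m p, either both lower base-p digits of k and l are at most
  -- m, or both exceed m; the latter terms vanish modulo p².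
  supercongruence : ∀ f → (∀ k l → f k l ≡ f l k) → f 0 0 ≡ 1ℤ →
    (∀ a a′ → a < p → a′ < p → f (a ℕ.* p) (a′ ℕ.* p) ≡ f a a′ [mod P ]) →
    (∀ b b′ → b < p → b′ < p → Digits f b b′) →
    (∀ i j k l → k ℕ.+ l ≡ h →
      f (k ℕ.+ suc m ℕ.+ i ℕ.* p) (l ℕ.+ suc m ℕ.+ j ℕ.* p) ≡ 0ℤ [mod P * P ]) →
    anti m f ≡ 0ℤ [mod P ] → anti (m ℕ.+ m ℕ.* p) f ≡ 0ℤ [mod P * P ]
  supercongruence f f-comm f₀≡1 f-lucas f-digits f-carry Σf≡0 = begin
    anti (m ℕ.+ m ℕ.* p) f
      ≈⟨ digit-split m f f-carry ⟩
    anti m (λ a a′ → anti m (λ b b′ → f (b ℕ.+ a ℕ.* p) (b′ ℕ.+ a′ ℕ.* p)))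
      ≈⟨ anti-mod m (λ a a′ _ → expansion A a a′) ⟩
    anti m (λ a a′ → w a a′ * (value A + P * (+ a * slopeˡ A + + a′ * slopeʳ A)))
      ≡⟨ anti-linear m w (value A) P (slopeˡ A) (slopeʳ A) ⟩
    value A * anti m w + P * (slopeˡ A * T + slopeʳ A * anti m (λ k l → + l * w k l))
      ≡⟨ cong (λ x → value A * anti m w + P * (slopeˡ A * T + slopeʳ A * x))
           (anti-first-moment-flip m w w-comm) ⟩
    value A * anti m w + P * (slopeˡ A * T + slopeʳ A * T)
      -- Each summand has two factors divisible by p: `value A` and the sum of `w` in the first, the
      -- explicit `P` and the moments `T` in the second.
      ≈⟨ mod-+ (mod-product value≡0 Σw≡0) (mod-product mod-self
           (mod-+ (mod-absorbʳ (slopeˡ A) T≡0) (mod-absorbʳ (slopeʳ A) T≡0))) ⟩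
    0ℤ
      ∎
    where
    open mod-Reasoning (P * P)
    w : ℕ → ℕ → ℤ
    w a a′ = f (a ℕ.* p) (a′ ℕ.* p)
    w-comm : ∀ a a′ → w a a′ ≡ w a′ a
    w-comm a a′ = f-comm (a ℕ.* p) (a′ ℕ.* p)
    T : ℤ
    T = anti m (λ k l → + k * w k l)
    addend<p : ∀ {k l} → k ℕ.+ l ≡ m → k < p × l < p
    addend<p {k} {l} eq = bound (subst (k ≤_) eq (ℕ.m≤m+n k l)) , bound (subst (l ≤_) eq (ℕ.m≤n+m l k))
      where
      bound : ∀ {k} → k ≤ m → k < p
      bound k≤m = s≤s (ℕ.≤-trans k≤m (ℕ.m≤m+n m m))
    A : Affine w (λ a a′ → anti m (λ b b′ → f (b ℕ.+ a ℕ.* p) (b′ ℕ.+ a′ ℕ.* p)))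
    A = affine-anti m (λ b b′ eq → f-digits b b′ (proj₁ (addend<p eq)) (proj₂ (addend<p eq)))
    Σw≡0 : anti m w ≡ 0ℤ [mod P ]
    Σw≡0 = mod-trans
      (anti-mod m (λ a a′ eq → f-lucas a a′ (proj₁ (addend<p eq)) (proj₂ (addend<p eq)))) Σf≡0
    T≡0 : T ≡ 0ℤ [mod P ]
    T≡0 = mod-cancel (prime⇒invertible p-prime 1 2<p)
      (mod-trans (exact (anti-first-moment m w w-comm)) (mod-absorbʳ (+ m) Σw≡0))
    -- At `a = a′ = 0` the expansion has weight `f 0 0 = 1`, so `value A` is congruent to
    -- `anti m f`.
    value≡0 : value A ≡ 0ℤ [mod P ]
    value≡0 = mod-linear
      (-1ℤ ⊙ mod-weaken P∣P² (expansion A 0 0) ⊕ 1ℤ ⊙ Σf′≡0 ⊕ value A ⊙ exact (sym f₀≡1))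
      (rearrange (value A) (anti m (λ k l → f (k ℕ.+ 0) (l ℕ.+ 0))) (f 0 0) P (slopeˡ A) (slopeʳ A))
      where
      Σf′≡0 : anti m (λ k l → f (k ℕ.+ 0) (l ℕ.+ 0)) ≡ 0ℤ [mod P ]
      Σf′≡0 = mod-trans (exact (anti-cong m (λ k l _ → cong₂ f (ℕ.+-identityʳ k) (ℕ.+-identityʳ l)))) Σf≡0
      rearrange : ∀ u x f₀ p v v′ → u - 0ℤ ≡
        -1ℤ * (x - f₀ * (u + p * (0ℤ * v + 0ℤ * v′))) + 1ℤ * (x - 0ℤ) + u * (1ℤ - f₀)
      rearrange = solve-∀

  upper<p : ∀ {k l} → k ℕ.+ l ≡ h → k ℕ.+ suc m < p
  upper<p {k} {l} eq = s≤s (subst (_≤ m ℕ.+ m) (sym (ℕ.+-suc k m))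
    (ℕ.+-monoˡ-≤ m (s≤s (subst (k ≤_) eq (ℕ.m≤m+n k l)))))

  p≤upper+upper : ∀ k l → p ≤ k ℕ.+ suc m ℕ.+ (l ℕ.+ suc m)
  p≤upper+upper k l =
    ℕ.+-mono-≤ (ℕ.m≤n+m (suc m) k) (ℕ.≤-trans (ℕ.n≤1+n m) (ℕ.m≤n+m (suc m) l))

  bin-upper : ∀ i j k l → k ℕ.+ l ≡ h →
    bin (k ℕ.+ suc m ℕ.+ i ℕ.* p) (l ℕ.+ suc m ℕ.+ j ℕ.* p) ≡ 0ℤ [mod P ]
  bin-upper i j k l eq = bin-carry-digits (k ℕ.+ suc m) (l ℕ.+ suc m)
    (upper<p eq) (upper<p (trans (ℕ.+-comm l k) eq)) (p≤upper+upper k l) i j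

  central-upper : ∀ i k l → k ℕ.+ l ≡ h → central (k ℕ.+ suc m ℕ.+ i ℕ.* p) ≡ 0ℤ [mod P ]
  central-upper i k l eq = bin-carry-digits (k ℕ.+ suc m) (k ℕ.+ suc m)
    (upper<p eq) (upper<p eq) (p≤upper+upper k k) i i

  s-supercongruence : s m ≡ 0ℤ [mod P ] → s (m ℕ.+ m ℕ.* p) ≡ 0ℤ [mod P * P ]
  s-supercongruence = supercongruence summand summand-comm refl
    (λ a a′ a<p a′<p → mod-* (bin-lucas a a′ a<p) (mod-* (bin-lucas a a a<p) (bin-lucas a′ a′ a′<p)))
    (λ b b′ b<p b′<p → affine-* (digits-bin b b′ b<p b′<p)
       (affine-* (digits-diagonal bin b b′ (digits-bin b b b<p b<p))
                 (digits-flip (λ k l → bin k k) b′ b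
                   (digits-diagonal bin b′ b (digits-bin b′ b′ b′<p b′<p)))))
    -- The two carries are taken from `bin k l` and `central k`.
    (λ i j k l eq → mod-product (bin-upper i j k l eq) (mod-absorbˡ _ (central-upper i k l eq)))

  cube-supercongruence : anti m cube ≡ 0ℤ [mod P ] → anti (m ℕ.+ m ℕ.* p) cube ≡ 0ℤ [mod P * P ]
  cube-supercongruence = supercongruence cube
    (λ k l → cong (λ x → x * (x * x)) (bin-comm k l)) refl
    (λ a a′ a<p _ → let b≡ = bin-lucas a a′ a<p in mod-* b≡ (mod-* b≡ b≡))
    (λ b b′ b<p b′<p → let B = digits-bin b b′ b<p b′<p in affine-* B (affine-* B B))
    (λ i j k l eq → let b≡0 = bin-upper i j k l eq in mod-product b≡0 (mod-absorbˡ _ b≡0))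

-- Vanishing modulo p

-- The double factorials (2n)!! and (2n - 1)!!, used to evaluate 2ᵐ modulo p.
evens odds : ℕ → ℤ
evens zero    = 1ℤ
evens (suc n) = evens n * (+ 2 * + suc n)
odds zero     = 1ℤ
odds (suc n)  = odds n * (+ 2 * + n + 1ℤ)

evens≡2^n*n! : ∀ n → evens n ≡ (+ 2) ℤ.^ n * + (n !)
evens≡2^n*n! zero    = refl
evens≡2^n*n! (suc n) = begin
  evens n * (+ 2 * + suc n)                     ≡⟨ cong (_* (+ 2 * + suc n)) (evens≡2^n*n! n) ⟩
  (+ 2) ℤ.^ n * + (n !) * (+ 2 * + suc n)       ≡⟨ regroup ((+ 2) ℤ.^ n) (+ (n !)) (+ suc n) ⟩
  + 2 * (+ 2) ℤ.^ n * (+ suc n * + (n !))       ≡⟨ cong (_*_ (+ 2 * (+ 2) ℤ.^ n)) (ℤ.pos-* (suc n) (n !)) ⟨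
  + 2 * (+ 2) ℤ.^ n * + (suc n !)               ∎
  where
  open ≡-Reasoning
  regroup : ∀ t f n → t * f * (+ 2 * n) ≡ + 2 * t * (n * f)
  regroup = solve-∀

-- Even and odd factors interleave, so the cases of even and odd length alternate in the induction.
-- They serve p ≡ 5 and p ≡ 7 modulo 8 respectively.
evens*odds : ∀ n → evens n * odds n ≡ + ((n ℕ.+ n) !)
evens*odds-suc : ∀ n → evens n * odds (suc n) ≡ + ((n ℕ.+ suc n) !)
evens*odds zero    = refl
evens*odds (suc n) = begin
  evens n * (+ 2 * + suc n) * odds (suc n)        ≡⟨ regroup (evens n) (+ n) (odds (suc n)) ⟩
  + suc (n ℕ.+ suc n) * (evens n * odds (suc n))  ≡⟨ cong (_*_ (+ suc (n ℕ.+ suc n))) (evens*odds-suc n) ⟩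
  + suc (n ℕ.+ suc n) * + ((n ℕ.+ suc n) !)       ≡⟨ ℤ.pos-* (suc (n ℕ.+ suc n)) ((n ℕ.+ suc n) !) ⟨
  + ((suc n ℕ.+ suc n) !)                         ∎
  where
  open ≡-Reasoning
  regroup : ∀ e n o → e * (+ 2 * (1ℤ + n)) * o ≡ (1ℤ + (n + (1ℤ + n))) * (e * o)
  regroup = solve-∀
evens*odds-suc n = begin
  evens n * (odds n * (+ 2 * + n + 1ℤ))       ≡⟨ regroup (evens n) (+ n) (odds n) ⟩
  + suc (n ℕ.+ n) * (evens n * odds n)        ≡⟨ cong (_*_ (+ suc (n ℕ.+ n))) (evens*odds n) ⟩
  + suc (n ℕ.+ n) * + ((n ℕ.+ n) !)           ≡⟨ ℤ.pos-* (suc (n ℕ.+ n)) ((n ℕ.+ n) !) ⟨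
  + (suc (n ℕ.+ n) !)                         ≡⟨ cong (λ i → + (i !)) (ℕ.+-suc n n) ⟨
  + ((n ℕ.+ suc n) !)                         ∎
  where
  open ≡-Reasoning
  regroup : ∀ e n o → e * (o * (+ 2 * n + 1ℤ)) ≡ (1ℤ + (n + n)) * (e * o)
  regroup = solve-∀

-1^n-square : ∀ n → -1ℤ ℤ.^ n * -1ℤ ℤ.^ n ≡ 1ℤ
-1^n-square zero    = refl
-1^n-square (suc n) = trans (negate-twice (-1ℤ ℤ.^ n)) (-1^n-square n)
  where
  negate-twice : ∀ x → -1ℤ * x * (-1ℤ * x) ≡ x * x
  negate-twice = solve-∀

-1^odd : ∀ t → -1ℤ ℤ.^ suc (t ℕ.+ t) ≡ -1ℤ
-1^odd t = cong (_*_ -1ℤ) (trans (ℤ.^-distribˡ-+-* -1ℤ t t) (-1^n-square t))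

module Residue (h : ℕ) (p-prime : Prime (suc (suc h ℕ.+ suc h))) where

  open Half h p-prime
  open Prime-mod (m ℕ.+ m) p-prime

  q : ℕ
  q = m ℕ.+ m

  -- Modulo p the recurrence is invariant under n ↦ p − 1 − n up to the scaling 32ⁿ.
  s-reflection : ∀ n l → n ℕ.+ l ≡ q → (+ 32) ℤ.^ n * s l ≡ s q * s n [mod P ]
  s-reflection zero    l refl = exact (ℤ.*-comm 1ℤ (s q))
  s-reflection (suc n) l eq = mod-cancel {u = + suc n * + suc n}
    (invertible-* n-invertible n-invertible)
    (mod-linear
      -- Since c ≡ -1 - n, the recurrences at `c` and at `n` have the same middle coefficient, while
      -- c² and (n + 1)² are exchanged. The last term corrects for c + n + 1 being 0 only modulo p.
      (t ⊙ exact (s-recurrence (suc l)) ⊕ (- s q) ⊙ exact (s-recurrence n) ⊕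
       (+ 4 * (+ 3 * + c * + c + + 3 * + c + 1ℤ)) ⊙ s-reflection n (suc l) n+c≡q ⊕
       -1ℤ ⊙ previous n c n+c≡q earlier ⊕
       (+ 12 * (+ c - + n) * (s q * s n) + + 32 * (1ℤ + + n - + c) * (t * s l)) ⊙ n+c+1≡0)
      (collect (+ n) (+ c) t (s l) (s c) (s (suc c)) (s q) (s n) (s (n ∸ 1)) (s (suc n))))
    where
    c : ℕ
    c = suc l
    t : ℤ
    t = (+ 32) ℤ.^ n
    n+c≡q : n ℕ.+ c ≡ q
    n+c≡q = trans (ℕ.+-suc n l) eq
    n-invertible : Invertible P (+ suc n)
    n-invertible = prime⇒invertible p-prime n (s≤s (subst (suc n ≤_) eq (ℕ.m≤m+n (suc n) l)))
    n+c+1≡0 : 1ℤ + (+ n + + c) ≡ 0ℤ [mod P ]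
    n+c+1≡0 = mod-trans (exact (cong (λ i → + suc i) n+c≡q)) mod-self
    earlier : ∀ n′ → n ≡ suc n′ → (+ 32) ℤ.^ n′ * s (suc c) ≡ s q * s n′ [mod P ]
    earlier n′ refl = s-reflection n′ (suc c) (trans (ℕ.+-suc n′ c) n+c≡q)
    -- The hypothesis two steps back, multiplied by its coefficient. At `n = 0` there is none, but
    -- then `1 + c = p` and the coefficient `n * n` is 0, so both sides vanish.
    previous : ∀ n c → n ℕ.+ c ≡ q →
      (∀ n′ → n ≡ suc n′ → (+ 32) ℤ.^ n′ * s (suc c) ≡ s q * s n′ [mod P ]) →
      (1ℤ + + c) * (1ℤ + + c) * ((+ 32) ℤ.^ n * s (suc c)) ≡
      + n * + n * (+ 32 * (s q * s (n ∸ 1))) [mod P ]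
    previous zero c refl _ = mod-linear ((P * (1ℤ * s (suc c))) ⊙ mod-self)
      (at-zero P (s (suc c)) (s q * s 0))
      where
      at-zero : ∀ p x y → p * p * (1ℤ * x) - 0ℤ * 0ℤ * (+ 32 * y) ≡ p * (1ℤ * x) * (p - 0ℤ)
      at-zero = solve-∀
    previous (suc n) c eq ih = mod-linear
      ((+ 32 * (+ suc n * + suc n)) ⊙ ih n refl ⊕
       ((1ℤ + + c - + suc n) * (+ 32 * (+ 32) ℤ.^ n * s (suc c))) ⊙
         mod-trans (exact (cong (λ i → + suc i) eq)) (mod-self {P}))
      (at-suc (+ suc n) (+ c) ((+ 32) ℤ.^ n) (s (suc c)) (s q * s n))
      where
      at-suc : ∀ n c t x y →
        (1ℤ + c) * (1ℤ + c) * (+ 32 * t * x) - n * n * (+ 32 * y) ≡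
        + 32 * (n * n) * (t * x - y) +
        (1ℤ + c - n) * (+ 32 * t * x) * (1ℤ + (n + c) - 0ℤ)
      at-suc = solve-∀
    collect : ∀ n c t s₋ s₀ s₊ z r₀ r₋ r₊ →
      (1ℤ + n) * (1ℤ + n) * (+ 32 * t * s₋) - (1ℤ + n) * (1ℤ + n) * (z * r₊) ≡
      t * ((1ℤ + c) * (1ℤ + c) * s₊ - (+ 4 * (+ 3 * c * c + + 3 * c + 1ℤ) * s₀ - + 32 * c * c * s₋)) +
      - z * ((1ℤ + n) * (1ℤ + n) * r₊ - (+ 4 * (+ 3 * n * n + + 3 * n + 1ℤ) * r₀ - + 32 * n * n * r₋)) +
      (+ 4 * (+ 3 * c * c + + 3 * c + 1ℤ)) * (t * s₀ - z * r₀) +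
      -1ℤ * ((1ℤ + c) * (1ℤ + c) * (t * s₊) - n * n * (+ 32 * (z * r₋))) +
      (+ 12 * (c - n) * (z * r₀) + + 32 * (1ℤ + n - c) * (t * s₋)) * (1ℤ + (n + c) - 0ℤ)
    collect = solve-∀

  -- In row p - 1 the ratio (l + 1) / (k + 1) of neighbouring coefficients is -1, because (k + 1) +
  -- (l + 1) = p.
  bin-alternating : ∀ k l → k ℕ.+ l ≡ q → bin k l ≡ -1ℤ ℤ.^ k [mod P ]
  bin-alternating zero    l _  = mod-refl
  bin-alternating (suc k) l eq = mod-cancel {u = + suc k} k-invertible
    (mod-linear
      (1ℤ ⊙ exact (bin-exchange k l) ⊕ (- + suc k) ⊙ bin-alternating k (suc l) eq′ ⊕
       bin k (suc l) ⊙ mod-trans (exact (cong (λ i → + suc i) eq′)) (mod-self {P}))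
      (collect (+ k) (+ l) (bin (suc k) l) (bin k (suc l)) (-1ℤ ℤ.^ k)))
    where
    eq′ : k ℕ.+ suc l ≡ q
    eq′ = trans (ℕ.+-suc k l) eq
    k-invertible : Invertible P (+ suc k)
    k-invertible = prime⇒invertible p-prime k (s≤s (subst (suc k ≤_) eq (ℕ.m≤m+n (suc k) l)))
    collect : ∀ k l x y e → (1ℤ + k) * x - (1ℤ + k) * (-1ℤ * e) ≡
      1ℤ * (x * (1ℤ + k) - y * (1ℤ + l)) + - (1ℤ + k) * (y - e) + y * (1ℤ + (k + (1ℤ + l)) - 0ℤ)
    collect = solve-∀

  central-vanish : ∀ k l → k ℕ.+ l ≡ h → central (k ℕ.+ suc m) ≡ 0ℤ [mod P ]
  central-vanish k l eq = subst (λ i → central i ≡ 0ℤ [mod P ])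
    (ℕ.+-identityʳ (k ℕ.+ suc m)) (central-upper 0 k l eq)

  -- Only the middle term survives modulo p.
  s-last : s q ≡ -1ℤ ℤ.^ m [mod P ]
  s-last = begin
    anti (m ℕ.+ suc h) summand
      ≡⟨ anti-split m h summand ⟩
    anti (suc h) (λ k l → summand k (l ℕ.+ m)) + anti h (λ k l → summand (k ℕ.+ suc m) l)
      ≡⟨ cong (_+ anti h (λ k l → summand (k ℕ.+ suc m) l)) (anti-last h (λ k l → summand k (l ℕ.+ m))) ⟩
    anti h (λ k l → summand k (suc l ℕ.+ m)) + summand m m + anti h (λ k l → summand (k ℕ.+ suc m) l)
      ≈⟨ mod-+ (mod-+
           (anti-vanish h (λ k l eq → mod-absorbʳ (bin k (suc l ℕ.+ m)) (mod-absorbʳ (central k)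
             (subst (λ i → central i ≡ 0ℤ [mod P ]) (ℕ.+-suc l m)
               (central-vanish l k (trans (ℕ.+-comm l k) eq))))))
           -- `summand m m` is the cube of `bin m m`.
           (mod-* middle (mod-* middle middle)))
           (anti-vanish h (λ k l eq → mod-absorbʳ (bin (k ℕ.+ suc m) l)
             (mod-absorbˡ (central l) (central-vanish k l eq)))) ⟩
    0ℤ + e * (e * e) + 0ℤ
      ≡⟨ cong (λ x → 0ℤ + e * x + 0ℤ) (-1^n-square m) ⟩
    0ℤ + e * 1ℤ + 0ℤ
      ≡⟨ simplify e ⟩
    e
      ∎
    where
    open mod-Reasoning P
    e : ℤ
    e = -1ℤ ℤ.^ m
    middle : bin m m ≡ e [mod P ]
    middle = bin-alternating m m refl
    simplify : ∀ e → 0ℤ + e * 1ℤ + 0ℤ ≡ e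
    simplify = solve-∀

  -- The r even numbers 2i with k < i ≤ m are p − (2j − 1) for 1 ≤ j ≤ r.
  evens-fold : ∀ k r → k ℕ.+ r ≡ m → evens m ≡ evens k * (-1ℤ ℤ.^ r * odds r) [mod P ]
  evens-fold k zero    eq = exact (trans (cong evens (trans (sym eq) (ℕ.+-identityʳ k)))
                                         (sym (ℤ.*-identityʳ (evens k))))
  evens-fold k (suc r) eq = mod-trans (evens-fold (suc k) r eq′)
    (mod-linear ((evens k * (-1ℤ ℤ.^ r * odds r)) ⊙ mod-trans (exact p≡) (mod-self {P}))
      (collect (evens k) (-1ℤ ℤ.^ r) (odds r) (+ k) (+ r)))
    where
    eq′ : suc k ℕ.+ r ≡ m
    eq′ = trans (sym (ℕ.+-suc k r)) eq
    p≡ : + suc (suc k ℕ.+ r ℕ.+ (suc k ℕ.+ r)) ≡ P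
    p≡ = cong (λ i → + suc (i ℕ.+ i)) eq′
    collect : ∀ e s o k r →
      e * (+ 2 * (1ℤ + k)) * (s * o) - e * (-1ℤ * s * (o * (+ 2 * r + 1ℤ))) ≡
      e * (s * o) * (1ℤ + (1ℤ + k + r + (1ℤ + k + r)) - 0ℤ)
    collect = solve-∀

  -- Gauss's lemma for 2: `evens m` is 2ᵐ m!, and reflecting its largest `r` factors at p costs
  -- (-1)ʳ and leaves m! again.
  2^m : ∀ k r → k ℕ.+ r ≡ m → evens k * odds r ≡ + ((k ℕ.+ r) !) → (+ 2) ℤ.^ m ≡ -1ℤ ℤ.^ r [mod P ]
  2^m k r eq product = mod-cancel {u = + (m !)} (invertible-! m (s≤s (ℕ.m≤m+n m m))) (begin
    + (m !) * (+ 2) ℤ.^ m                ≡⟨ ℤ.*-comm (+ (m !)) ((+ 2) ℤ.^ m) ⟩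
    (+ 2) ℤ.^ m * + (m !)                ≡⟨ evens≡2^n*n! m ⟨
    evens m                              ≈⟨ evens-fold k r eq ⟩
    evens k * (-1ℤ ℤ.^ r * odds r)       ≡⟨ regroup (evens k) (-1ℤ ℤ.^ r) (odds r) ⟩
    evens k * odds r * -1ℤ ℤ.^ r         ≡⟨ cong (_* -1ℤ ℤ.^ r) (trans product (cong (λ i → + (i !)) eq)) ⟩
    + (m !) * -1ℤ ℤ.^ r                  ∎)
    where
    open mod-Reasoning P
    regroup : ∀ e s o → e * (s * o) ≡ e * o * s
    regroup = solve-∀

  -- The residue class enters through the odd `k = 2t + 1`: as m = k + r, the signs (-1)ᵐ and (-1)ʳ
  -- ≡ 2ᵐ are opposite, so `s m` is multiplied by opposite units on the two sides of the reflection
  -- at m.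
  s-middle : ∀ t r → suc (t ℕ.+ t) ℕ.+ r ≡ m →
    evens (suc (t ℕ.+ t)) * odds r ≡ + ((suc (t ℕ.+ t) ℕ.+ r) !) → s m ≡ 0ℤ [mod P ]
  s-middle t r eq product = mod-cancel (prime⇒invertible p-prime 1 2<p) (begin
    + 2 * s m                                       ≡⟨ cong (_* s m) two ⟩
    ε * (ε * (ε * ε * (ε * ε)) - - ε) * s m         ≡⟨ regroup ε (ε * (ε * ε * (ε * ε))) (- ε) (s m) ⟩
    ε * (ε * (ε * ε * (ε * ε)) * s m - - ε * s m)   ≈⟨ mod-absorbʳ ε difference ⟩
    0ℤ                                              ∎)
    where
    open mod-Reasoning P
    k : ℕ
    k = suc (t ℕ.+ t)
    ε : ℤ
    ε = -1ℤ ℤ.^ r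
    ε²≡1 : ε * ε ≡ 1ℤ
    ε²≡1 = -1^n-square r
    2^m≡ε : (+ 2) ℤ.^ m ≡ ε [mod P ]
    2^m≡ε = 2^m k r eq product
    -1^m≡-ε : -1ℤ ℤ.^ m ≡ - ε
    -1^m≡-ε = trans (cong (-1ℤ ℤ.^_) (sym eq)) (trans (ℤ.^-distribˡ-+-* -1ℤ k r)
      (trans (cong (_* ε) (-1^odd t)) (ℤ.-1*i≡-i ε)))
    -- The difference of the two units is ε⁵ + ε, with ε⁵ coming from 32 = 2⁵; a further factor ε
    -- makes it ε⁶ + ε² = 2.
    two : + 2 ≡ ε * (ε * (ε * ε * (ε * ε)) - - ε)
    two = sym (trans (factor ε) (cong (λ x → x * (x * x + 1ℤ)) ε²≡1))
      where
      factor : ∀ ε → ε * (ε * (ε * ε * (ε * ε)) - - ε) ≡ ε * ε * (ε * ε * (ε * ε) + 1ℤ)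
      factor = solve-∀
    regroup : ∀ ε x y s → ε * (x - y) * s ≡ ε * (x * s - y * s)
    regroup = solve-∀
    fifth : ∀ x → x ℤ.^ 5 ≡ x * (x * x * (x * x))
    fifth x = quintic x
      where
      quintic : ∀ x → x * (x * (x * (x * (x * 1ℤ)))) ≡ x * (x * x * (x * x))
      quintic = solve-∀
    32^m≡ : (+ 32) ℤ.^ m ≡ ε * (ε * ε * (ε * ε)) [mod P ]
    32^m≡ = begin
      ((+ 2) ℤ.^ 5) ℤ.^ m      ≡⟨ ℤ.^-*-assoc (+ 2) 5 m ⟩
      (+ 2) ℤ.^ (5 ℕ.* m)      ≡⟨ cong ((+ 2) ℤ.^_) (ℕ.*-comm 5 m) ⟩
      (+ 2) ℤ.^ (m ℕ.* 5)      ≡⟨ ℤ.^-*-assoc (+ 2) m 5 ⟨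
      ((+ 2) ℤ.^ m) ℤ.^ 5      ≡⟨ fifth ((+ 2) ℤ.^ m) ⟩
      x * (x * x * (x * x))    ≈⟨ mod-* 2^m≡ε (mod-* (mod-* 2^m≡ε 2^m≡ε) (mod-* 2^m≡ε 2^m≡ε)) ⟩
      ε * (ε * ε * (ε * ε))    ∎
      where
      x : ℤ
      x = (+ 2) ℤ.^ m
    difference : ε * (ε * ε * (ε * ε)) * s m - - ε * s m ≡ 0ℤ [mod P ]
    difference = mod-linear
      ((- s m) ⊙ 32^m≡ ⊕ 1ℤ ⊙ s-reflection m m refl ⊕ (s m) ⊙ s-last ⊕ (s m) ⊙ exact -1^m≡-ε)
      (combine (ε * (ε * ε * (ε * ε))) (- ε) (s m) ((+ 32) ℤ.^ m) (s q) (-1ℤ ℤ.^ m))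
      where
      combine : ∀ x y s t z e → x * s - y * s - 0ℤ ≡
        - s * (t - x) + 1ℤ * (t * s - z * s) + s * (z - e) + s * (e - y)
      combine = solve-∀

  -- Both sides have the same ratios of consecutive terms: 2(2k + 1) ≡ -4(m - k) because 2m ≡ -1.
  central-binomial : ∀ k l → k ℕ.+ l ≡ m → central k ≡ (- + 4) ℤ.^ k * bin k l [mod P ]
  central-binomial zero    l _  = mod-refl
  central-binomial (suc k) l eq = mod-cancel {u = + suc k} k-invertible
    (mod-linear
      (1ℤ ⊙ exact (central-suc k) ⊕ (+ 2 * (+ 2 * + k + 1ℤ)) ⊙ central-binomial k (suc l) eq′ ⊕
       (+ 4 * (- + 4) ℤ.^ k) ⊙ exact (bin-exchange k l) ⊕
       (+ 2 * ((- + 4) ℤ.^ k * bin k (suc l))) ⊙ mod-trans (exact p≡) (mod-self {P}))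
      (collect (+ k) (+ l) (central (suc k)) (central k) ((- + 4) ℤ.^ k) (bin (suc k) l) (bin k (suc l))))
    where
    eq′ : k ℕ.+ suc l ≡ m
    eq′ = trans (ℕ.+-suc k l) eq
    p≡ : + suc (k ℕ.+ suc l ℕ.+ (k ℕ.+ suc l)) ≡ P
    p≡ = cong (λ i → + suc (i ℕ.+ i)) eq′
    k-invertible : Invertible P (+ suc k)
    k-invertible = prime⇒invertible p-prime k
      (s≤s (ℕ.≤-trans (subst (suc k ≤_) eq (ℕ.m≤m+n (suc k) l)) (ℕ.m≤m+n m m)))
    collect : ∀ k l c⁺ c t b⁺ b → (1ℤ + k) * c⁺ - (1ℤ + k) * (- + 4 * t * b⁺) ≡
      1ℤ * (c⁺ * (1ℤ + k) - c * (+ 2 * (+ 2 * k + 1ℤ))) +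
      + 2 * (+ 2 * k + 1ℤ) * (c - t * b) +
      + 4 * t * (b⁺ * (1ℤ + k) - b * (1ℤ + l)) +
      + 2 * (t * b) * (1ℤ + (k + (1ℤ + l) + (k + (1ℤ + l))) - 0ℤ)
    collect = solve-∀

  s≡cubes : s m ≡ (- + 4) ℤ.^ m * anti m cube [mod P ]
  s≡cubes = mod-trans (anti-mod m termwise) (exact (anti-*ˡ m ((- + 4) ℤ.^ m) cube))
    where
    open mod-Reasoning P
    termwise : ∀ k l → k ℕ.+ l ≡ m → summand k l ≡ (- + 4) ℤ.^ m * cube k l [mod P ]
    termwise k l eq = begin
      bin k l * (central k * central l)
        ≈⟨ mod-*ˡ (bin k l) (mod-* (central-binomial k l eq)
             (mod-trans (central-binomial l k (trans (ℕ.+-comm l k) eq))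
               (exact (cong (_*_ ((- + 4) ℤ.^ l)) (bin-comm l k))))) ⟩
      bin k l * ((- + 4) ℤ.^ k * bin k l * ((- + 4) ℤ.^ l * bin k l))
        ≡⟨ regroup (bin k l) ((- + 4) ℤ.^ k) ((- + 4) ℤ.^ l) ⟩
      (- + 4) ℤ.^ k * (- + 4) ℤ.^ l * cube k l
        ≡⟨ cong (_* cube k l) (ℤ.^-distribˡ-+-* (- + 4) k l) ⟨
      (- + 4) ℤ.^ (k ℕ.+ l) * cube k l
        ≡⟨ cong (λ n → (- + 4) ℤ.^ n * cube k l) eq ⟩
      (- + 4) ℤ.^ m * cube k l
        ∎
      where
      regroup : ∀ b x y → b * (x * b * (y * b)) ≡ x * y * (b * (b * b))
      regroup = solve-∀

  cubes-middle : s m ≡ 0ℤ [mod P ] → anti m cube ≡ 0ℤ [mod P ]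
  cubes-middle s≡0 = mod-cancel {u = (- + 4) ℤ.^ m} (power-invertible m)
    (mod-trans (mod-sym s≡cubes) (mod-trans s≡0 (exact (sym (ℤ.*-zeroʳ ((- + 4) ℤ.^ m))))))
    where
    2-invertible : Invertible P (+ 2)
    2-invertible = prime⇒invertible p-prime 1 2<p
    power-invertible : ∀ n → Invertible P ((- + 4) ℤ.^ n)
    power-invertible zero    = has-inverse 1ℤ mod-refl
    power-invertible (suc n) = invertible-* {u = - + 4}
      -- -4 is split as -1 times 2 times 2, and 2 is a unit as p is odd.
      (invertible-* {u = -1ℤ} (has-inverse -1ℤ mod-refl) (invertible-* 2-invertible 2-invertible))
      (power-invertible n)

-- From congruences to divisibility at the index (p² - 1)/2

module Conclusion (h : ℕ) (p-prime : Prime (suc (suc h ℕ.+ suc h))) where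

  open Half h p-prime
  open Prime-mod (m ℕ.+ m) p-prime
  open Residue h p-prime

  index : (p ^ 2 ∸ 1) / 2 ≡ m ℕ.+ m ℕ.* p
  index = trans (cong (λ n → (n ∸ 1) / 2) (square m)) (m*n/n≡m (m ℕ.+ m ℕ.* p) 2)
    where
    square : ∀ m → suc (m ℕ.+ m) ℕ.* (suc (m ℕ.+ m) ℕ.* 1) ≡ suc ((m ℕ.+ m ℕ.* suc (m ℕ.+ m)) ℕ.* 2)
    square = ℕ.solve-∀

  p²∣ : ∀ {x} → x ≡ 0ℤ [mod P * P ] → + (p ^ 2) ∣ℤ x
  p²∣ {x} (congruent P²∣x-0) = ∣⇒∣ᵤ (subst₂ _∣ₛ_
    (trans (sym (ℤ.pos-* p p)) (cong (λ i → + (p ℕ.* i)) (sym (ℕ.*-identityʳ p))))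
    (ℤ.+-identityʳ x) P²∣x-0)

  p²-divides : s m ≡ 0ℤ [mod P ] →
    ((S : ℕ → ℤ) → IsSSequence S → + (p ^ 2) ∣ℤ S ((p ^ 2 ∸ 1) / 2)) ×
    p ^ 2 ∣ franel ((p ^ 2 ∸ 1) / 2)
  p²-divides s≡0 =
    (λ S isS → p²∣ (mod-trans
      (exact (trans (cong S index) (s-unique S isS (m ℕ.+ m ℕ.* p)))) (s-supercongruence s≡0))) ,
    p²∣ (mod-trans
      (exact (trans (cong (λ n → + franel n) index) (franel≡cubes (m ℕ.+ m ℕ.* p))))
      (cube-supercongruence (cubes-middle s≡0)))

-- Common form of both residue classes: among 1, ..., m there are 2t + 1 even and `r` odd numbers,
-- and `product` records that together they give m!.
p²-divides-both : ∀ t r → evens (suc (t ℕ.+ t)) * odds r ≡ + ((suc (t ℕ.+ t) ℕ.+ r) !) →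
  ∀ {p} → p ≡ suc (suc (t ℕ.+ t) ℕ.+ r ℕ.+ (suc (t ℕ.+ t) ℕ.+ r)) → Prime p →
  ((S : ℕ → ℤ) → IsSSequence S → + (p ^ 2) ∣ℤ S ((p ^ 2 ∸ 1) / 2)) ×
  p ^ 2 ∣ franel ((p ^ 2 ∸ 1) / 2)
p²-divides-both t r product refl p-prime =
  Conclusion.p²-divides h p-prime (Residue.s-middle h p-prime t r refl product)
  where
  h : ℕ
  h = t ℕ.+ t ℕ.+ r

theorem3p5 : (p : ℕ) → Prime p → (p % 8 ≡ 5) ⊎ (p % 8 ≡ 7) →
    ((S : ℕ → ℤ) → IsSSequence S → + (p ^ 2) ∣ℤ S ((p ^ 2 ∸ 1) / 2))
    × (p ^ 2 ∣ franel ((p ^ 2 ∸ 1) / 2))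
theorem3p5 p p-prime (inj₁ p%8≡5) = p²-divides-both t k (evens*odds k) p≡ p-prime
  where
  -- p = 8t + 5 gives m = 2k, hence `r = k`.
  t k : ℕ
  t = p / 8
  k = suc (t ℕ.+ t)
  expand : ∀ t → 5 ℕ.+ t ℕ.* 8 ≡
    suc (suc (t ℕ.+ t) ℕ.+ suc (t ℕ.+ t) ℕ.+ (suc (t ℕ.+ t) ℕ.+ suc (t ℕ.+ t)))
  expand = ℕ.solve-∀
  p≡ : p ≡ suc (k ℕ.+ k ℕ.+ (k ℕ.+ k))
  p≡ = trans (m≡m%n+[m/n]*n p 8) (trans (cong (ℕ._+ t ℕ.* 8) p%8≡5) (expand t))
theorem3p5 p p-prime (inj₂ p%8≡7) = p²-divides-both t (suc k) (evens*odds-suc k) p≡ p-prime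
  where
  -- p = 8t + 7 gives m = 2k + 1, hence `r = suc k`.
  t k : ℕ
  t = p / 8
  k = suc (t ℕ.+ t)
  expand : ∀ t → 7 ℕ.+ t ℕ.* 8 ≡
    suc (suc (t ℕ.+ t) ℕ.+ suc (suc (t ℕ.+ t)) ℕ.+ (suc (t ℕ.+ t) ℕ.+ suc (suc (t ℕ.+ t))))
  expand = ℕ.solve-∀
  p≡ : p ≡ suc (k ℕ.+ suc k ℕ.+ (k ℕ.+ suc k))
  p≡ = trans (m≡m%n+[m/n]*n p 8) (trans (cong (ℕ._+ t ℕ.* 8) p%8≡7) (expand t))
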